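{- Let $\sigma$ be a switch table for a subgroup $G$ of $\mathrm{Sym}(n)$ with maximal effective row $r$ and $c_i$ non-trivial switches in row $i$, $i=1,2,\dots,r$, such that $\gamma_1(m)=0$. (This is, e.g., the case whenever $G$ is transitive.) Denote by $r(j)$ the number of effective rows with index strictly larger than $j$. Define $\mu:=\frac{n-1}{n}$ and assume that $\rho_r(m)^2+\mu^2\le1$. Then the relative effort of $\sigma$ satisfies $$\mathrm{eff}_{\mathrm{mst}}(m)\le\Bigl(1+\sum_{j=1}^{r}\frac{1}{2^{r(j)}}\cdot\frac{c_j}{c_j+1}\Bigr)\rho_1(m)^2\le3\,\rho_1(m)^2 .$$
   Context: Throughout $1\le m<n$, $[n]=\{1,\dots,n\}$. Switch tables. For a subgroup $G\le\mathrm{Sym}(n)$ of order $k$, a switch table is a map $(i,j)\mapsto\sigma_{i,j}\in G$ on $[n]\times[n]$ such that for $j>i$, if some $g\in G$ has $g(j)=i$ and $g(t)=t$ for all $t<i$, then $\sigma_{i,j}$ is one such $g$; otherwise $\sigma_{i,j}=\mathrm{id}$. Non-identity entries are non-trivial; a row is effective if it has a non-trivial entry; $r$ is the largest index of an effective row; $J(i)$ is the set of columns of non-trivial entries in row $i$ and $c_i=|J(i)|$. One has $k=\prod_{j=1}^r(c_j+1)$. Parameters. For $0<\ell<n-i+1$: $\rho_i(\ell):=\frac{\ell}{n-i+1}$; for $\ell\le0$ or $\ell\ge n-i+1$: $\rho_i(\ell):=0$. With $(x)_\ell:=x(x-1)\cdots(x-\ell+1)$, the transitivity gap is $\gamma_i(\ell):=\frac{(n-i+1-(c_i+1))_\ell}{(n-i+1)_\ell}$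 for $0\le\ell\le n-i-c_i$ and $\gamma_i(\ell):=0$ for $\ell>n-i-c_i$. Modified switch-table method and cost. A call at level $i$ takes subsets $S,S'\subseteq\{i,\dots,n\}$ with $|S|=|S'|=\ell$; it is started at level $1$ with $\ell=m$. If $\ell=0$, or $i\le r$ and $\ell=n-i+1$, it returns at no cost. If $i=r+1$ and $\ell\ge1$, $S$ and $S'$ are compared lexicographically, counted as $\ell$ single-element evaluations. Otherwise: (element branch, $i\in S$) if $i\in S'$, make a call at level $i+1$ with $S\setminus\{i\},S'\setminus\{i\}$; and for each $j\in J(i)\cap S'$ compute $\sigma_{i,j}(S'\setminus\{j\})$ ($\ell-1$ evaluations) and make a call at level $i+1$ with $S\setminus\{i\}$ and this image; (non-element branch, $i\notin S$) if $i\in S'$ or $J(i)\cap S'\ne\emptyset$, return at no cost; otherwise make a call at level $i+1$ with $S,S'$, and for each $j\in J(i)$ compute $\sigma_{i,j}(S')$ ($\ell$ evaluations) and make a call at level $i+1$ with $S$ and this image. A negative answer of a recursive call does not stop the algorithm; all branches are carried out. Typical number $E_{\mathrm{mst}}(m)$: the expected total number of evaluations in the paper's simplified ("hyper-amortized") uniform model, in which in every call at level $i$ with cardinality $\ell$ the two subsets are regarded as independent and uniformly random $\ell$-subsets of $\{i,\dots,n\}$, disregarding their dependence on the subsets of earlier calls. Relative effort: $\mathrm{eff}_{\mathrm{mst}}(m):=E_{\mathrm{mst}}(m)/(km)$, where $km$ is the number of single-element evaluations of the naive method (apply each of the $k$ permutations to all $m$ elements). -}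

module Defs where

open import Data.Bool.Base using (if_then_else_; _∨_)
open import Data.Fin.Base as Fin using (Fin; toℕ)
import Data.Fin.Properties as Fin
open import Data.Fin.Permutation
  using (Permutation′; _⟨$⟩ʳ_; _⟨$⟩ˡ_; _≈_; id; flip; _∘ₚ_)
open import Data.Fin.Subset
  using (Subset; Nonempty; inside; outside; _∈_; _∩_; _-_; ∣_∣)
open import Data.Fin.Subset.Properties using (_∈?_; _⊆?_; nonempty?)
open import Data.Integer.Base using (+_)
open import Data.List.Base
  using (List; []; _∷_; _++_; [_]; map; filter; foldr; length; allFin;
         cartesianProduct)
open import Data.Nat.Base as ℕ using (ℕ; zero; suc; _∸_)
import Data.Nat.Properties as ℕ
open import Data.Nat.Combinatorics using (_P_)
open import Data.Product.Base using (∃; _×_; _,_; proj₁)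
open import Data.Rational.Base using (ℚ; 0ℚ; 1ℚ; _+_; _*_; _/_)
open import Data.Vec.Base as Vec using (lookup; tabulate)
open import Function.Bundles using (Bijection)
open import Level using (Level)
import Relation.Binary.Construct.On as On
open import Relation.Binary.Bundles using (Setoid)
import Relation.Binary.PropositionalEquality as ≡
open import Relation.Binary.PropositionalEquality using (_≡_; _→-setoid_)
open import Relation.Nullary using (Dec; does; ¬_; ¬?; _×-dec_)

private
  variable
    a p : Level
    A : Set a
    n : ℕ

------------------------------------------------------------------------
-- Rational arithmetic

fromℕ : ℕ → ℚ
fromℕ x = + x / 1

infixl 7 _/ℕ_

-- The value 0ℚ for denominator 0 only makes the operation total; no
-- quantity below depends on it in the range where it is meaningful.
_/ℕ_ : ℚ → ℕ → ℚ
q /ℕ zero    = 0ℚ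
q /ℕ (suc d) = q * (+ 1 / suc d)

infix 8 _²

_² : ℚ → ℚ
q ² = q * q

∑ : List A → (A → ℚ) → ℚ
∑ xs f = foldr (λ x s → f x + s) 0ℚ xs

infix 5 ∑
syntax ∑ xs (λ x → e) = ∑[ x ∈ xs ] e

-- Expectation of f under the uniform distribution on the entries of xs.
mean : List A → (A → ℚ) → ℚ
mean xs f = ∑ xs f /ℕ length xs

------------------------------------------------------------------------
-- Finite sets

elements : Subset n → List (Fin n)
elements S = filter (_∈? S) (allFin _)

allSubsets : ∀ n → List (Subset n)
allSubsets zero    = [ Vec.[] ]
allSubsets (suc n) =
  map (inside Vec.∷_) (allSubsets n) ++ map (outside Vec.∷_) (allSubsets n)

-- {i,…,n}
from : Fin n → Subset n
from i = tabulate (λ j → does (i Fin.≤? j))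

subsetsFrom : Fin n → ℕ → List (Subset n)
subsetsFrom i ℓ =
  filter (λ S → (S ⊆? from i) ×-dec (∣ S ∣ ℕ.≟ ℓ)) (allSubsets _)

-- { π(x) | x ∈ S }: y is in the image iff π⁻¹(y) ∈ S.
image : Permutation′ n → Subset n → Subset n
image π S = tabulate (λ y → lookup S (π ⟨$⟩ˡ y))

------------------------------------------------------------------------
-- Permutation groups

record Subgroup (n : ℕ) (p : Level) : Set (Level.suc p) where
  field
    Member       : Permutation′ n → Set p
    resp         : ∀ {g h} → g ≈ h → Member g → Member h
    id-closed    : Member id
    ∘-closed     : ∀ {g h} → Member g → Member h → Member (g ∘ₚ h)
    flip-closed  : ∀ {g} → Member g → Member (flip g)

  -- Elements are identified when they agree as functions on Fin n.
  setoid : Setoid p Level.zero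
  setoid = On.setoid (Fin n →-setoid Fin n)
                     (λ (g : ∃ Member) → proj₁ g ⟨$⟩ʳ_)

open Subgroup using (Member)

HasOrder : Subgroup n p → ℕ → Set p
HasOrder G k = Bijection (Subgroup.setoid G) (≡.setoid (Fin k))

Transitive : Subgroup n p → Set p
Transitive G = ∀ x y → ∃ λ g → Member G g × g ⟨$⟩ʳ x ≡ y

------------------------------------------------------------------------
-- Switch tables
--
-- Rows and columns are indexed by Fin n, so the 1-based index i of the
-- literature is represented by the element of value i − 1, and
-- n − i + 1 becomes n ∸ toℕ i.

IsSwitch : Subgroup n p → Fin n → Fin n → Permutation′ n → Set p
IsSwitch G i j g =
  Member G g × (g ⟨$⟩ʳ j ≡ i) × (∀ t → t Fin.< i → g ⟨$⟩ʳ t ≡ t)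

record SwitchTable (G : Subgroup n p) : Set p where
  field
    σ        : Fin n → Fin n → Permutation′ n
    σ∈G      : ∀ i j → Member G (σ i j)
    switch   : ∀ i j → i Fin.< j → ∃ (IsSwitch G i j) →
               IsSwitch G i j (σ i j)
    -- In particular all entries with j ≤ i are the identity.
    identity : ∀ i j → ¬ (i Fin.< j × ∃ (IsSwitch G i j)) → σ i j ≈ id

  nonTrivial? : ∀ i j → Dec (¬ (σ i j ≈ id))
  nonTrivial? i j = ¬? (Fin.all? (λ t → (σ i j ⟨$⟩ʳ t) Fin.≟ t))

  J : Fin n → Subset n
  J i = tabulate (λ j → does (nonTrivial? i j))

  c : Fin n → ℕ
  c i = ∣ J i ∣

  Effective : Fin n → Set
  Effective i = Nonempty (J i)

  IsMaxEffective : Fin n → Set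
  IsMaxEffective r = Effective r × (∀ i → r Fin.< i → ¬ Effective i)

  effectiveAfter : Fin n → ℕ
  effectiveAfter j =
    length (filter (λ i → (j Fin.<? i) ×-dec nonempty? (J i)) (allFin n))

-- The rows 1,…,r in increasing order.
rowsUpTo : Fin n → List (Fin n)
rowsUpTo r = filter (Fin._≤? r) (allFin _)

------------------------------------------------------------------------
-- Parameters

μ : ℕ → ℚ
μ n = fromℕ (n ∸ 1) /ℕ n

ρ : Fin n → ℕ → ℚ
ρ {n} i ℓ =
  if does ((0 ℕ.<? ℓ) ×-dec (ℓ ℕ.<? n ∸ toℕ i))
  then fromℕ ℓ /ℕ (n ∸ toℕ i)
  else 0ℚ

module _ {G : Subgroup n p} (T : SwitchTable G) where
  open SwitchTable T

  γ : Fin n → ℕ → ℚ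
  γ i ℓ =
    if does (ℓ ℕ.≤? N ∸ (c i ℕ.+ 1))
    then fromℕ ((N ∸ (c i ℕ.+ 1)) P ℓ) /ℕ (N P ℓ)
    else 0ℚ
    where N = n ∸ toℕ i

------------------------------------------------------------------------
-- The modified switch-table method

-- A recursive call on (S , S′), preceded by the given number of
-- single-element evaluations.
record Call (n : ℕ) : Set where
  constructor call
  field
    evaluations : ℕ
    S S′        : Subset n

module _ {G : Subgroup n p} (T : SwitchTable G) where
  open SwitchTable T

  step : Fin n → Subset n → Subset n → List (Call n)
  step i S S′ =
    if does (i ∈? S) then
      (if does (i ∈? S′) then [ call 0 (S - i) (S′ - i) ] else [])
      ++ map (λ j → call ∣ S′ - j ∣ (S - i) (image (σ i j) (S′ - j)))
             (elements (J i ∩ S′))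
    else if does (i ∈? S′) ∨ does (nonempty? (J i ∩ S′)) then []
    else
      call 0 S S′
      ∷ map (λ j → call ∣ S′ ∣ S (image (σ i j) S′)) (elements (J i))

  -- Expected number of evaluations caused by a call of cardinality ℓ,
  -- where the list holds the rows from the current level up to r (the
  -- empty list is level r + 1).  The model draws the two subsets of each
  -- call afresh, so a recursive call enters only via its cardinality.
  expectedCost : List (Fin n) → ℕ → ℚ
  expectedCost []         ℓ = fromℕ ℓ
  expectedCost (i ∷ rows) ℓ =
    if does (ℓ ℕ.≟ 0) ∨ does (ℓ ℕ.≟ n ∸ toℕ i)
    then 0ℚ
    else mean (cartesianProduct (subsetsFrom i ℓ) (subsetsFrom i ℓ))
           λ (S , S′) → ∑ (step i S S′)
             λ (call e R R′) → fromℕ e + expectedCost rows ∣ R ∣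

  Eₘₛₜ : Fin n → ℕ → ℚ
  Eₘₛₜ r m = expectedCost (rowsUpTo r) m

  effₘₛₜ : Fin n → ℕ → ℕ → ℚ
  effₘₛₜ r k m = Eₘₛₜ r m /ℕ (k ℕ.* m)

  boundFactor : Fin n → ℚ
  boundFactor r =
    1ℚ + (∑[ j ∈ rowsUpTo r ]
            (1ℚ /ℕ (2 ℕ.^ effectiveAfter j))
            * (fromℕ (c j) /ℕ (c j ℕ.+ 1)))

{-# OPTIONS --safe #-}

-- In row 1 the vanishing gap γ₁(m) leaves only the element branch: no m-subset
-- avoids 1 and J(1).  Since every point lies in the fraction m/n of all
-- m-subsets, that branch contributes the factor ρ₁(m)².  From row 2 on the
-- trivial bound suffices, in which every pair of sets makes c i + 1 calls and
-- evaluates c i images; it yields E ≤ ρ₁(m)² m W with W = 2 ∏ (c i + 1) − 1.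
-- Row by row, W ≤ ∏ (c i + 1) · boundFactor because the rows after j have
-- ∏ (c i + 1) ≥ 2^r(j), and ∏ (c i + 1) ≤ k because products of one switch per
-- row are distinct elements of G.

module Submission where

open import Defs
open import Data.Bool.Base using (true; false; if_then_else_)
open import Data.Fin.Base as Fin using (Fin; zero; suc; toℕ; fromℕ<; remQuot; combine)
import Data.Fin.Properties as Fin
open import Data.Fin.Permutation using (Permutation′; _⟨$⟩ʳ_; _⟨$⟩ˡ_; _≈_; inverseˡ; inverseʳ; _∘ₚ_) renaming (id to idₚ)
open import Data.Fin.Subset using (Subset; inside; outside; _∩_; _⊂_; _⊆_; ∣_∣; ⊤; ∁; ⁅_⁆; _-_; Nonempty)
open import Data.Fin.Subset.Properties
  using (_∈?_; _⊆?_; nonempty?; drop-there; Empty-unique; ∣⊥∣≡0; ∣⊤∣≡n; ∣⁅x⁆∣≡1; ∣p∣≤n; ∣∁p∣≡n∸∣p∣;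
         ∣p∩q∣≤∣p∣; ∣p∩q∣≤∣q∣; ∣p─q∣≤∣p∣; ∩-identityˡ; p⊆q⇒∣p∣≤∣q∣; p⊂q⇒∣p∣<∣q∣; x∈⁅x⁆; x∉p⇒x∈∁p;
         x∈∁p⇒x∉p; x∈p∩q⁺; x∈p⇒∣p-x∣<∣p∣)
open import Data.List.Base using (List; []; _∷_; _++_; [_]; map; filter; length; lookup; tabulate; allFin; cartesianProduct)
open import Data.List.Properties using (map-++; map-∘; map-cong; map-tabulate; length-map; length-++; filter-++; filter-≐; filter-none; filter-accept; filter-reject)
import Data.List.Membership.Propositional as List
open import Data.List.Membership.Propositional.Properties using (∈-filter⁻; ∈-filter⁺; ∈-allFin; ∈-lookup; ∈-cartesianProduct⁻)
open import Data.List.Membership.Propositional.Properties.WithK using (unique∧set⇒bag)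
open import Data.List.Relation.Binary.BagAndSetEquality using (∼bag⇒↭)
open import Data.List.Relation.Binary.Permutation.Propositional.Properties using (↭-length)
open import Data.List.Relation.Unary.All as All using (All; []; _∷_)
open import Data.List.Relation.Unary.AllPairs as AllPairs using (AllPairs; []; _∷_)
import Data.List.Relation.Unary.AllPairs.Properties as AllPairs
open import Data.List.Relation.Unary.Any using (here; there)
open import Data.List.Relation.Unary.Unique.Propositional using (Unique)
import Data.List.Relation.Unary.Unique.Propositional.Properties as Unique
open import Data.Nat.Base as ℕ using (ℕ; zero; suc; _<_; _∸_; _^_; z≤n; s≤s; z<s)
import Data.Nat.Properties as ℕ
open import Data.Nat.Combinatorics using (_P_; nPk≡n!/[n∸k]!)
open import Data.Nat.DivMod using (m≥n⇒m/n>0)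
open import Data.Nat.Divisibility using (∣⇒≤; m≤n⇒m!∣n!)
open import Data.Nat.ListAction using (sum; product)
open import Data.Nat.ListAction.Properties using (sum-++)
import Data.Nat.Tactic.RingSolver as ℕ-Solver
open import Data.Product.Base using (_×_; _,_; proj₁; proj₂; ∃; uncurry)
import Data.Vec.Base as Vec
import Data.Vec.Properties as Vec
open import Function.Base using (_∘_; id; case_of_)
open import Function.Bundles using (Bijection; mk⇔)
open import Relation.Binary.PropositionalEquality hiding (J; [_])
open import Relation.Nullary using (¬_; Dec; does; yes; no; contradiction; _×-dec_; Reflects; proof; invert)
open import Relation.Nullary.Decidable using (decidable-stable; dec-true; dec-false)
open import Relation.Unary using (Pred; Decidable)

-- The bound on a pair (S , S′) in row 1 is a function of S times a function of S′, so its sum over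
-- all pairs is a product of two sums. One factor ρ₁(m) comes from 1 ∈ S. The other comes from the
-- intersections of S′ with {1} and J(1), whose sizes count the recursive calls. For this reason the
-- calls are counted by intersection sizes, which can be summed over all sets. From row 2 on, the
-- bound is linear in the cardinality, with a weight that depends only on the rows. This separates
-- the cost from the cardinalities that the calls happen to produce. In W, the comparisons at the
-- ends of the recursion tree account for ∏ (c i + 1), and the images computed inside the tree for ∏
-- (c i + 1) - 1. The constant 3 is 1 + 2: a row without switches contributes nothing to the sum,
-- and since c/(c + 1) ≤ 1 the effective rows, counted from the last one, contribute at most 1, 1/2,
-- 1/4, and so on.

private
  variable
    n : ℕ

-- Counting ℓ-subsets and their incidences with a fixed set

module SubsetCounting where
  open import Data.Nat.Base using (_+_; _*_; _≤_)
  open import Data.Nat.Properties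
  open import Data.List.Membership.Propositional using (_∈_)

  module _ {a} {A : Set a} where

    sum-map-≤ : ∀ (xs : List A) {f : A → ℕ} {b} → (∀ x → f x ≤ b) →
                sum (map f xs) ≤ length xs * b
    sum-map-≤ []       f≤b = z≤n
    sum-map-≤ (x ∷ xs) f≤b = +-mono-≤ (f≤b x) (sum-map-≤ xs f≤b)

    sum-map-const : ∀ (xs : List A) {f : A → ℕ} {c} → (∀ {x} → x ∈ xs → f x ≡ c) →
                    sum (map f xs) ≡ length xs * c
    sum-map-const []       f≡c = refl
    sum-map-const (x ∷ xs) f≡c = cong₂ _+_ (f≡c (here refl)) (sum-map-const xs (f≡c ∘ there))

    sum-map-+ : ∀ (xs : List A) (f g : A → ℕ) →
                sum (map (λ x → f x + g x) xs) ≡ sum (map f xs) + sum (map g xs)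
    sum-map-+ []       f g = refl
    sum-map-+ (x ∷ xs) f g rewrite sum-map-+ xs f g = lemma (f x) (g x) (sum (map f xs)) (sum (map g xs))
      where
      lemma : ∀ a b c d → a + b + (c + d) ≡ a + c + (b + d)
      lemma = ℕ-Solver.solve-∀

    sum-map-*ˡ : ∀ c (xs : List A) (f : A → ℕ) → sum (map (λ x → c * f x) xs) ≡ c * sum (map f xs)
    sum-map-*ˡ c []       f = sym (*-zeroʳ c)
    sum-map-*ˡ c (x ∷ xs) f = trans (cong (c * f x +_) (sum-map-*ˡ c xs f)) (sym (*-distribˡ-+ c (f x) _))

    sum-map-*ʳ : ∀ c (xs : List A) (f : A → ℕ) → sum (map (λ x → f x * c) xs) ≡ sum (map f xs) * c
    sum-map-*ʳ c xs f = trans (cong sum (map-cong (λ x → *-comm (f x) c) xs))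
                              (trans (sum-map-*ˡ c xs f) (*-comm c _))

    filter-map : ∀ {b p} {B : Set b} {P : Pred B p} (P? : Decidable P) (f : A → B) (xs : List A) →
                 filter P? (map f xs) ≡ map f (filter (P? ∘ f) xs)
    filter-map P? f []       = refl
    filter-map P? f (x ∷ xs) with does (P? (f x))
    ... | true  = cong (f x ∷_) (filter-map P? f xs)
    ... | false = filter-map P? f xs

  sum-cartesianProduct : ∀ {a b} {A : Set a} {B : Set b} (f : A → ℕ) (g : B → ℕ) xs ys →
                         sum (map (λ (x , y) → f x * g y) (cartesianProduct xs ys))
                           ≡ sum (map f xs) * sum (map g ys)
  sum-cartesianProduct f g []       ys = refl
  sum-cartesianProduct f g (x ∷ xs) ys = begin
    sum (map h (map (x ,_) ys ++ cartesianProduct xs ys))               ≡⟨ cong sum (map-++ h (map (x ,_) ys) _) ⟩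
    sum (map h (map (x ,_) ys) ++ map h (cartesianProduct xs ys))       ≡⟨ sum-++ (map h (map (x ,_) ys)) _ ⟩
    sum (map h (map (x ,_) ys)) + sum (map h (cartesianProduct xs ys))  ≡⟨ cong₂ _+_ (cong sum (sym (map-∘ ys))) (sum-cartesianProduct f g xs ys) ⟩
    sum (map (λ y → f x * g y) ys) + sum (map f xs) * sum (map g ys)    ≡⟨ cong (_+ sum (map f xs) * sum (map g ys)) (sum-map-*ˡ (f x) ys g) ⟩
    f x * sum (map g ys) + sum (map f xs) * sum (map g ys)              ≡⟨ *-distribʳ-+ (sum (map g ys)) (f x) (sum (map f xs)) ⟨
    (f x + sum (map f xs)) * sum (map g ys)                             ∎
    where
    open ≡-Reasoning
    h = λ (x , y) → f x * g y

  length-cartesianProduct : ∀ {a b} {A : Set a} {B : Set b} (xs : List A) (ys : List B) →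
                            length (cartesianProduct xs ys) ≡ length xs * length ys
  length-cartesianProduct xs ys = begin
    length (cartesianProduct xs ys)                  ≡⟨ *-identityʳ _ ⟨
    length (cartesianProduct xs ys) * 1              ≡⟨ sum-map-const (cartesianProduct xs ys) (λ _ → refl) ⟨
    sum (map (λ _ → 1) (cartesianProduct xs ys))     ≡⟨ sum-cartesianProduct (λ _ → 1) (λ _ → 1) xs ys ⟩
    sum (map (λ _ → 1) xs) * sum (map (λ _ → 1) ys)  ≡⟨ cong₂ _*_ (sum-map-const xs (λ _ → refl)) (sum-map-const ys (λ _ → refl)) ⟩
    length xs * 1 * (length ys * 1)                  ≡⟨ cong₂ _*_ (*-identityʳ (length xs)) (*-identityʳ (length ys)) ⟩
    length xs * length ys                            ∎
    where open ≡-Reasoning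

  length-elements : (S : Subset n) → length (elements S) ≡ ∣ S ∣
  length-elements Vec.[] = refl
  length-elements {suc n} (s Vec.∷ S) = helper s tail-elements
    where
    open ≡-Reasoning
    P? = λ (x : Fin n) → suc x ∈? (s Vec.∷ S)
    tail-elements : length (filter (_∈? (s Vec.∷ S)) (tabulate suc)) ≡ ∣ S ∣
    tail-elements = begin
      length (filter (_∈? (s Vec.∷ S)) (tabulate suc))        ≡⟨ cong (length ∘ filter (_∈? (s Vec.∷ S))) (map-tabulate id suc) ⟨
      length (filter (_∈? (s Vec.∷ S)) (map suc (allFin n)))  ≡⟨ cong length (filter-map (_∈? (s Vec.∷ S)) suc (allFin n)) ⟩
      length (map Fin.suc (filter P? (allFin n)))             ≡⟨ length-map Fin.suc (filter P? (allFin n)) ⟩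
      length (filter P? (allFin n))                           ≡⟨ cong length (filter-≐ P? (_∈? S) (drop-there , Vec.there) (allFin n)) ⟩
      length (elements S)                                     ≡⟨ length-elements S ⟩
      ∣ S ∣                                                   ∎
    helper : ∀ s → length (filter (_∈? (s Vec.∷ S)) (tabulate suc)) ≡ ∣ S ∣ →
             length (elements (s Vec.∷ S)) ≡ ∣ s Vec.∷ S ∣
    helper inside  = cong suc
    helper outside = id

  ksubsets : ∀ n → ℕ → List (Subset n)
  ksubsets n ℓ = filter (λ S → ∣ S ∣ ≟ ℓ) (allSubsets n)

  ksubsets-suc-zero : ∀ n → ksubsets (suc n) zero ≡ map (outside Vec.∷_) (ksubsets n zero)
  ksubsets-suc-zero n = begin
    ksubsets (suc n) zero  ≡⟨ filter-++ P? (map (inside Vec.∷_) (allSubsets n)) _ ⟩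
    filter P? (map (inside Vec.∷_) (allSubsets n)) ++ filter P? (map (outside Vec.∷_) (allSubsets n))
      ≡⟨ cong₂ _++_ (filter-map P? (inside Vec.∷_) (allSubsets n)) (filter-map P? (outside Vec.∷_) (allSubsets n)) ⟩
    map (inside Vec.∷_) (filter (λ S → suc ∣ S ∣ ≟ 0) (allSubsets n)) ++ map (outside Vec.∷_) (ksubsets n zero)
      ≡⟨ cong (λ xs → map (inside Vec.∷_) xs ++ map (outside Vec.∷_) (ksubsets n zero)) (filter-none (λ S → suc ∣ S ∣ ≟ 0) (All.universal (λ _ ()) (allSubsets n))) ⟩
    map (outside Vec.∷_) (ksubsets n zero)  ∎
    where
    open ≡-Reasoning
    P? = λ (S : Subset (suc n)) → ∣ S ∣ ≟ 0

  ksubsets-suc-suc : ∀ n ℓ → ksubsets (suc n) (suc ℓ) ≡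
                     map (inside Vec.∷_) (ksubsets n ℓ) ++ map (outside Vec.∷_) (ksubsets n (suc ℓ))
  ksubsets-suc-suc n ℓ = begin
    ksubsets (suc n) (suc ℓ)  ≡⟨ filter-++ P? (map (inside Vec.∷_) (allSubsets n)) _ ⟩
    filter P? (map (inside Vec.∷_) (allSubsets n)) ++ filter P? (map (outside Vec.∷_) (allSubsets n))
      ≡⟨ cong₂ _++_ (filter-map P? (inside Vec.∷_) (allSubsets n)) (filter-map P? (outside Vec.∷_) (allSubsets n)) ⟩
    map (inside Vec.∷_) (filter (λ S → suc ∣ S ∣ ≟ suc ℓ) (allSubsets n)) ++ map (outside Vec.∷_) (ksubsets n (suc ℓ))
      ≡⟨ cong (λ xs → map (inside Vec.∷_) xs ++ map (outside Vec.∷_) (ksubsets n (suc ℓ)))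
          (filter-≐ (λ S → suc ∣ S ∣ ≟ suc ℓ) (λ S → ∣ S ∣ ≟ ℓ) (suc-injective , cong suc) (allSubsets n)) ⟩
    map (inside Vec.∷_) (ksubsets n ℓ) ++ map (outside Vec.∷_) (ksubsets n (suc ℓ)) ∎
    where
    open ≡-Reasoning
    P? = λ (S : Subset (suc n)) → ∣ S ∣ ≟ suc ℓ

  ∈-ksubsets⁻ : ∀ {ℓ} {S : Subset n} → S ∈ ksubsets n ℓ → ∣ S ∣ ≡ ℓ
  ∈-ksubsets⁻ {n} {ℓ} S∈ = proj₂ (∈-filter⁻ (λ S → ∣ S ∣ ≟ ℓ) {xs = allSubsets n} S∈)

  ∑∣_∩-∣ : Subset n → ℕ → ℕ
  ∑∣_∩-∣ {n} J ℓ = sum (map (λ S → ∣ J ∩ S ∣) (ksubsets n ℓ))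

  ∑∣∩∣-zero : (J : Subset n) → ∑∣ J ∩-∣ 0 ≡ 0
  ∑∣∩∣-zero {n} J = trans
    (sum-map-const (ksubsets n 0) (λ {S} S∈ → n≤0⇒n≡0 (≤-trans (∣p∩q∣≤∣q∣ J S) (≤-reflexive (∈-ksubsets⁻ S∈)))))
    (*-zeroʳ (length (ksubsets n 0)))

  -- Pascal's rule with weights: the (ℓ + 1)-subsets are split by whether they contain the first
  -- point. The first summand collects the incidences at that point itself.
  ∑∣∩∣-∷ : ∀ s (J : Subset n) ℓ → ∑∣ s Vec.∷ J ∩-∣ (suc ℓ) ≡
           length (ksubsets n ℓ) * ∣ s Vec.∷ Vec.[] ∣ + (∑∣ J ∩-∣ ℓ + ∑∣ J ∩-∣ (suc ℓ))
  ∑∣∩∣-∷ {n} s J ℓ = begin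
    sum (map f (ksubsets (suc n) (suc ℓ)))                                  ≡⟨ cong (sum ∘ map f) (ksubsets-suc-suc n ℓ) ⟩
    sum (map f (map (inside Vec.∷_) L ++ map (outside Vec.∷_) L′))          ≡⟨ cong sum (map-++ f (map (inside Vec.∷_) L) _) ⟩
    sum (map f (map (inside Vec.∷_) L) ++ map f (map (outside Vec.∷_) L′))  ≡⟨ sum-++ (map f (map (inside Vec.∷_) L)) _ ⟩
    sum (map f (map (inside Vec.∷_) L)) + sum (map f (map (outside Vec.∷_) L′))
      ≡⟨ cong₂ _+_ (cong sum (sym (map-∘ L))) (cong sum (sym (map-∘ L′))) ⟩
    sum (map (f ∘ (inside Vec.∷_)) L) + sum (map (f ∘ (outside Vec.∷_)) L′)
      ≡⟨ cong₂ _+_ (cong sum (map-cong (inside-case s) L)) (cong sum (map-cong (outside-case s) L′)) ⟩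
    sum (map (λ S → ∣ s Vec.∷ Vec.[] ∣ + ∣ J ∩ S ∣) L) + ∑∣ J ∩-∣ (suc ℓ)
      ≡⟨ cong (_+ ∑∣ J ∩-∣ (suc ℓ)) (sum-map-+ L (λ _ → ∣ s Vec.∷ Vec.[] ∣) _) ⟩
    sum (map (λ _ → ∣ s Vec.∷ Vec.[] ∣) L) + ∑∣ J ∩-∣ ℓ + ∑∣ J ∩-∣ (suc ℓ)
      ≡⟨ +-assoc (sum (map (λ _ → ∣ s Vec.∷ Vec.[] ∣) L)) _ _ ⟩
    sum (map (λ _ → ∣ s Vec.∷ Vec.[] ∣) L) + (∑∣ J ∩-∣ ℓ + ∑∣ J ∩-∣ (suc ℓ))
      ≡⟨ cong (_+ _) (sum-map-const L (λ _ → refl)) ⟩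
    length L * ∣ s Vec.∷ Vec.[] ∣ + (∑∣ J ∩-∣ ℓ + ∑∣ J ∩-∣ (suc ℓ)) ∎
    where
    open ≡-Reasoning
    L  = ksubsets n ℓ
    L′ = ksubsets n (suc ℓ)
    f = λ S → ∣ (s Vec.∷ J) ∩ S ∣
    inside-case : ∀ s S → ∣ (s Vec.∷ J) ∩ (inside Vec.∷ S) ∣ ≡ ∣ s Vec.∷ Vec.[] ∣ + ∣ J ∩ S ∣
    inside-case inside  S = refl
    inside-case outside S = refl
    outside-case : ∀ s S → ∣ (s Vec.∷ J) ∩ (outside Vec.∷ S) ∣ ≡ ∣ J ∩ S ∣
    outside-case inside  S = refl
    outside-case outside S = refl

  length-ksubsets-suc-suc : ∀ n ℓ → length (ksubsets (suc n) (suc ℓ)) ≡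
                            length (ksubsets n ℓ) + length (ksubsets n (suc ℓ))
  length-ksubsets-suc-suc n ℓ = begin
    length (ksubsets (suc n) (suc ℓ))  ≡⟨ cong length (ksubsets-suc-suc n ℓ) ⟩
    length (map (inside Vec.∷_) (ksubsets n ℓ) ++ map (outside Vec.∷_) (ksubsets n (suc ℓ)))
      ≡⟨ length-++ (map (inside Vec.∷_) (ksubsets n ℓ)) ⟩
    length (map (inside Vec.∷_) (ksubsets n ℓ)) + length (map (outside Vec.∷_) (ksubsets n (suc ℓ)))
      ≡⟨ cong₂ _+_ (length-map _ (ksubsets n ℓ)) (length-map _ (ksubsets n (suc ℓ))) ⟩
    length (ksubsets n ℓ) + length (ksubsets n (suc ℓ)) ∎
    where open ≡-Reasoning

  -- Every element lies in equally many ℓ-subsets.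
  ∑∣∩∣-suc  : ∀ (J : Subset (suc n)) ℓ → ∑∣ J ∩-∣ (suc ℓ) ≡ ∣ J ∣ * length (ksubsets n ℓ)
  -- The form in which `∑∣∩∣-∷` leaves the tail. The two lemmas are proved together: the first
  -- reduces to this one on a smaller ground set, and this one follows from the first at two
  -- consecutive cardinalities by Pascal's rule.
  ∑∣∩∣-pair : ∀ (J : Subset n) ℓ → ∑∣ J ∩-∣ ℓ + ∑∣ J ∩-∣ (suc ℓ) ≡ ∣ J ∣ * length (ksubsets n ℓ)

  ∑∣∩∣-suc {n} (s Vec.∷ J) ℓ = begin
    ∑∣ s Vec.∷ J ∩-∣ (suc ℓ)                                         ≡⟨ ∑∣∩∣-∷ s J ℓ ⟩
    length L * ∣ s Vec.∷ Vec.[] ∣ + (∑∣ J ∩-∣ ℓ + ∑∣ J ∩-∣ (suc ℓ))  ≡⟨ cong (length L * ∣ s Vec.∷ Vec.[] ∣ +_) (∑∣∩∣-pair J ℓ) ⟩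
    length L * ∣ s Vec.∷ Vec.[] ∣ + ∣ J ∣ * length L                 ≡⟨ cong (_+ ∣ J ∣ * length L) (*-comm (length L) ∣ s Vec.∷ Vec.[] ∣) ⟩
    ∣ s Vec.∷ Vec.[] ∣ * length L + ∣ J ∣ * length L                 ≡⟨ *-distribʳ-+ (length L) ∣ s Vec.∷ Vec.[] ∣ ∣ J ∣ ⟨
    (∣ s Vec.∷ Vec.[] ∣ + ∣ J ∣) * length L                          ≡⟨ cong (_* length L) (∣∷∣ s) ⟩
    ∣ s Vec.∷ J ∣ * length L                                         ∎
    where
    open ≡-Reasoning
    L = ksubsets n ℓ
    ∣∷∣ : ∀ s → ∣ s Vec.∷ Vec.[] ∣ + ∣ J ∣ ≡ ∣ s Vec.∷ J ∣
    ∣∷∣ inside  = refl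
    ∣∷∣ outside = refl

  ∑∣∩∣-pair Vec.[] zero    = refl
  ∑∣∩∣-pair Vec.[] (suc ℓ) = refl
  ∑∣∩∣-pair {suc n} J zero = begin
    ∑∣ J ∩-∣ 0 + ∑∣ J ∩-∣ 1                               ≡⟨ cong₂ _+_ (∑∣∩∣-zero J) (∑∣∩∣-suc J 0) ⟩
    ∣ J ∣ * length (ksubsets n 0)                         ≡⟨ cong (∣ J ∣ *_) (length-map (outside Vec.∷_) (ksubsets n 0)) ⟨
    ∣ J ∣ * length (map (outside Vec.∷_) (ksubsets n 0))  ≡⟨ cong (λ xs → ∣ J ∣ * length xs) (ksubsets-suc-zero n) ⟨
    ∣ J ∣ * length (ksubsets (suc n) 0)                   ∎
    where open ≡-Reasoning
  ∑∣∩∣-pair {suc n} J (suc ℓ) = begin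
    ∑∣ J ∩-∣ (suc ℓ) + ∑∣ J ∩-∣ (suc (suc ℓ))                            ≡⟨ cong₂ _+_ (∑∣∩∣-suc J ℓ) (∑∣∩∣-suc J (suc ℓ)) ⟩
    ∣ J ∣ * length (ksubsets n ℓ) + ∣ J ∣ * length (ksubsets n (suc ℓ))  ≡⟨ *-distribˡ-+ ∣ J ∣ _ _ ⟨
    ∣ J ∣ * (length (ksubsets n ℓ) + length (ksubsets n (suc ℓ)))        ≡⟨ cong (∣ J ∣ *_) (length-ksubsets-suc-suc n ℓ) ⟨
    ∣ J ∣ * length (ksubsets (suc n) (suc ℓ))                            ∎
    where open ≡-Reasoning

  -- Double counting of the pairs of a point and an (ℓ + 1)-subset containing it, obtained from
  -- `∑∣∩∣-suc` with the full set.
  length-ksubsets-absorption : ∀ n ℓ → suc n * length (ksubsets n ℓ) ≡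
                               suc ℓ * length (ksubsets (suc n) (suc ℓ))
  length-ksubsets-absorption n ℓ = begin
    suc n * length (ksubsets n ℓ)              ≡⟨ cong (_* length (ksubsets n ℓ)) (∣⊤∣≡n (suc n)) ⟨
    ∣ ⊤ {suc n} ∣ * length (ksubsets n ℓ)      ≡⟨ ∑∣∩∣-suc (⊤ {suc n}) ℓ ⟨
    ∑∣ ⊤ {suc n} ∩-∣ (suc ℓ)                   ≡⟨ sum-map-const (ksubsets (suc n) (suc ℓ)) (λ {S} S∈ → trans (cong ∣_∣ (∩-identityˡ S)) (∈-ksubsets⁻ S∈)) ⟩
    length (ksubsets (suc n) (suc ℓ)) * suc ℓ  ≡⟨ *-comm (length (ksubsets (suc n) (suc ℓ))) (suc ℓ) ⟩
    suc ℓ * length (ksubsets (suc n) (suc ℓ))  ∎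
    where open ≡-Reasoning

open SubsetCounting

-- Switch tables and products of one switch per row

module Switches where
  open import Data.Fin.Subset using (_∈_; _∉_)
  open import Data.Nat.Base using (_+_; _*_; _≤_)
  open import Data.Nat.Properties hiding (nonTrivial?)

  module _ {n p} {P : Fin n → Set p} (P? : ∀ j → Dec (P j)) where

    ∈-tabulate-does⁻ : ∀ {j} → j ∈ Vec.tabulate (does ∘ P?) → P j
    ∈-tabulate-does⁻ {j} j∈ = invert (subst (Reflects (P j))
      (trans (sym (Vec.lookup∘tabulate (does ∘ P?) j)) (Vec.[]=⇒lookup j∈)) (proof (P? j)))

    ∈-tabulate-does⁺ : ∀ {j} → P j → j ∈ Vec.tabulate (does ∘ P?)
    ∈-tabulate-does⁺ {j} Pj =
      Vec.lookup⇒[]= j _ (trans (Vec.lookup∘tabulate (does ∘ P?) j) (dec-true (P? j) Pj))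

  Unique⇒lookup-injective : ∀ {a} {A : Set a} {xs : List A} → Unique xs →
                            ∀ i j → lookup xs i ≡ lookup xs j → i ≡ j
  Unique⇒lookup-injective (x∉ ∷ xs!) zero    zero    eq = refl
  Unique⇒lookup-injective (x∉ ∷ xs!) zero    (suc j) eq = contradiction eq (All.lookup x∉ (∈-lookup j))
  Unique⇒lookup-injective (x∉ ∷ xs!) (suc i) zero    eq = contradiction (sym eq) (All.lookup x∉ (∈-lookup i))
  Unique⇒lookup-injective (x∉ ∷ xs!) (suc i) (suc j) eq = cong suc (Unique⇒lookup-injective xs! i j eq)

  ∈-elements⁻ : ∀ {n} {S : Subset n} {x} → x List.∈ elements S → x ∈ S
  ∈-elements⁻ {S = S} x∈ = proj₂ (∈-filter⁻ (_∈? S) {xs = allFin _} x∈)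

  Nonempty⇒1≤∣p∣ : ∀ {n} {S : Subset n} → Nonempty S → 1 ≤ ∣ S ∣
  Nonempty⇒1≤∣p∣ (x , x∈S) = ≤-trans (s≤s z≤n) (x∈p⇒∣p-x∣<∣p∣ x∈S)

  module _ {n p} {G : Subgroup n p} (T : SwitchTable G) where
    open Subgroup G using (Member)
    open SwitchTable T

    -- Contrapositive of `identity`. As `Member` need not be decidable, this yields only the double
    -- negation of the existence of a switch. The order and the fixed-point conditions are decidable
    -- and therefore stable, and membership in G is supplied by `σ∈G`.
    ∈J⇒IsSwitch : ∀ {i j} → j ∈ J i → i Fin.< j × IsSwitch G i j (σ i j)
    ∈J⇒IsSwitch {i} {j} j∈J =
        decidable-stable (i Fin.<? j) (λ i≮j → ¬¬switch (λ i<j _ → i≮j i<j))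
      , σ∈G i j
      , decidable-stable (_ Fin.≟ _) (λ ≢i → ¬¬switch (λ i<j ex → ≢i (proj₁ (proj₂ (switch i j i<j ex)))))
      , λ t t<i → decidable-stable (_ Fin.≟ _) (λ ≢t → ¬¬switch (λ i<j ex → ≢t (proj₂ (proj₂ (switch i j i<j ex)) t t<i)))
      where
      ¬¬switch : ¬ (i Fin.< j → ¬ ∃ (IsSwitch G i j))
      ¬¬switch h = ∈-tabulate-does⁻ (nonTrivial? i) j∈J (identity i j (uncurry h))

    i∉Ji : ∀ {i} → i ∉ J i
    i∉Ji i∈J = Fin.<-irrefl refl (proj₁ (∈J⇒IsSwitch i∈J))

    -- Column i is included because its entry is the identity: these columns index all c i + 1
    -- choices in row i, the trivial one among them.
    columns : Fin n → List (Fin n)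
    columns i = i ∷ elements (J i)

    columns-unique : ∀ i → Unique (columns i)
    columns-unique i = All.tabulate (λ j∈ i≡j → i∉Ji (subst (_∈ J i) (sym i≡j) (∈-elements⁻ j∈)))
      ∷ Unique.filter⁺ (_∈? J i) (Unique.allFin⁺ n)

    column-switch : ∀ {i j} → j List.∈ columns i → IsSwitch G i j (σ i j)
    column-switch {i} (here refl) = σ∈G i i , σ≈id i , λ t _ → σ≈id t
      where σ≈id = identity i i (λ (i<i , _) → Fin.<-irrefl refl i<i)
    column-switch (there j∈) = proj₂ (∈J⇒IsSwitch (∈-elements⁻ j∈))

    #switches : List (Fin n) → ℕ
    #switches rows = product (map (suc ∘ c) rows)

    private
      size : List (Fin n) → ℕ
      size rows = product (map (length ∘ columns) rows)

      column : ∀ i rows → Fin (size (i ∷ rows)) → Fin (length (columns i))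
      column i rows x = proj₁ (remQuot {length (columns i)} (size rows) x)

      rest : ∀ i rows → Fin (size (i ∷ rows)) → Fin (size rows)
      rest i rows x = proj₂ (remQuot {length (columns i)} (size rows) x)

    -- The row-i switch acts first, so that the column chosen in row i is the
    -- preimage of i under the product; hence distinct choices of columns give
    -- distinct group elements.
    switches : ∀ rows → Fin (size rows) → Permutation′ n
    switches []         _ = idₚ
    switches (i ∷ rows) x = σ i (lookup (columns i) (column i rows x)) ∘ₚ switches rows (rest i rows x)

    switches-member : ∀ rows x → Member (switches rows x)
    switches-member []         x = Subgroup.id-closed G
    switches-member (i ∷ rows) x = Subgroup.∘-closed G (σ∈G i _) (switches-member rows _)

    switches-fix : ∀ rows {t} → All (t Fin.<_) rows → ∀ x → switches rows x ⟨$⟩ʳ t ≡ t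
    switches-fix []         []             x = refl
    switches-fix (i ∷ rows) {t} (t<i ∷ t<rows) x =
      trans (cong (switches rows (rest i rows x) ⟨$⟩ʳ_)
              (proj₂ (proj₂ (column-switch (∈-lookup {xs = columns i} (column i rows x)))) t t<i))
            (switches-fix rows t<rows (rest i rows x))

    switches-↦ : ∀ i rows → All (i Fin.<_) rows →
                 ∀ x → switches (i ∷ rows) x ⟨$⟩ʳ lookup (columns i) (column i rows x) ≡ i
    switches-↦ i rows i<rows x =
      trans (cong (switches rows (rest i rows x) ⟨$⟩ʳ_)
              (proj₁ (proj₂ (column-switch (∈-lookup {xs = columns i} (column i rows x))))))
            (switches-fix rows i<rows (rest i rows x))

    switches-injective : ∀ {rows} → AllPairs Fin._<_ rows →
                         ∀ {x y} → switches rows x ≈ switches rows y → x ≡ y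
    switches-injective []              {zero} {zero} _ = refl
    switches-injective {i ∷ rows} (i<rows ∷ sorted) {x} {y} x≈y = begin
      x                                          ≡⟨ Fin.combine-remQuot {length (columns i)} (size rows) x ⟨
      combine (column i rows x) (rest i rows x)  ≡⟨ cong₂ combine a≡a′ b≡b′ ⟩
      combine (column i rows y) (rest i rows y)  ≡⟨ Fin.combine-remQuot {length (columns i)} (size rows) y ⟩
      y                                          ∎
      where
      open ≡-Reasoning
      πx = switches (i ∷ rows) x
      πy = switches (i ∷ rows) y
      b  = rest i rows x
      b′ = rest i rows y
      j  = lookup (columns i) (column i rows x)
      j′ = lookup (columns i) (column i rows y)

      j≡j′ : j ≡ j′
      j≡j′ = begin
        j                     ≡⟨ inverseˡ πx ⟨
        πx ⟨$⟩ˡ (πx ⟨$⟩ʳ j)   ≡⟨ cong (πx ⟨$⟩ˡ_) (trans (switches-↦ i rows i<rows x) (sym (switches-↦ i rows i<rows y))) ⟩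
        πx ⟨$⟩ˡ (πy ⟨$⟩ʳ j′)  ≡⟨ cong (πx ⟨$⟩ˡ_) (x≈y j′) ⟨
        πx ⟨$⟩ˡ (πx ⟨$⟩ʳ j′)  ≡⟨ inverseˡ πx ⟩
        j′                    ∎

      a≡a′ : column i rows x ≡ column i rows y
      a≡a′ = Unique⇒lookup-injective (columns-unique i) _ _ j≡j′

      -- Equal columns mean equal row-i switches. These act first, so they cancel when both products
      -- are precomposed with the inverse.
      b≡b′ : b ≡ b′
      b≡b′ = switches-injective sorted (λ t → begin
        switches rows b ⟨$⟩ʳ t                              ≡⟨ cong (switches rows b ⟨$⟩ʳ_) (inverseʳ (σ i j)) ⟨
        πx ⟨$⟩ʳ (σ i j ⟨$⟩ˡ t)                              ≡⟨ x≈y _ ⟩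
        switches rows b′ ⟨$⟩ʳ (σ i j′ ⟨$⟩ʳ (σ i j ⟨$⟩ˡ t))  ≡⟨ cong (λ h → switches rows b′ ⟨$⟩ʳ (σ i h ⟨$⟩ʳ (σ i j ⟨$⟩ˡ t))) j≡j′ ⟨
        switches rows b′ ⟨$⟩ʳ (σ i j ⟨$⟩ʳ (σ i j ⟨$⟩ˡ t))   ≡⟨ cong (switches rows b′ ⟨$⟩ʳ_) (inverseʳ (σ i j)) ⟩
        switches rows b′ ⟨$⟩ʳ t                             ∎)

    #switches≤order : ∀ {rows k} → AllPairs Fin._<_ rows → HasOrder G k → #switches rows ≤ k
    #switches≤order {rows} {k} sorted order = subst (_≤ k)
      (cong product (map-cong (λ i → cong suc (length-elements (J i))) rows))
      (Fin.injective⇒≤ {f = λ x → to (switches rows x , switches-member rows x)}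
        (λ eq → switches-injective sorted (injective eq)))
      where open Bijection order using (to; injective)

    -- Effective rows within a sorted list of rows

    #effective : List (Fin n) → ℕ
    #effective rows = length (filter (nonempty? ∘ J) rows)

    -- The invariant that passes from `rowsUpTo r` to its tails. It allows `effectiveAfter`, which
    -- counts among all rows, to be computed from the rest of the list.
    UpwardComplete : List (Fin n) → Set
    UpwardComplete rows = AllPairs Fin._<_ rows ×
      (∀ {i j} → i List.∈ rows → i Fin.< j → Effective j → j List.∈ rows)

    tail-complete : ∀ {i rows} → UpwardComplete (i ∷ rows) → UpwardComplete rows
    tail-complete {i} {rows} (i<rows ∷ sorted , complete) = sorted , complete′
      where
      complete′ : ∀ {j k} → j List.∈ rows → j Fin.< k → Effective k → k List.∈ rows
      complete′ j∈ j<k eff with complete (there j∈) j<k eff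
      ... | here refl = contradiction (All.lookup i<rows j∈) (<-asym j<k)
      ... | there k∈  = k∈

    effectiveAfter≡ : ∀ {i rows} → UpwardComplete (i ∷ rows) → effectiveAfter i ≡ #effective rows
    effectiveAfter≡ {i} {rows} (i<rows ∷ sorted , complete) = ↭-length (∼bag⇒↭ (unique∧set⇒bag
      (Unique.filter⁺ After? (Unique.allFin⁺ n))
      (Unique.filter⁺ (nonempty? ∘ J) (AllPairs.map (λ i<j i≡j → Fin.<-irrefl i≡j i<j) sorted))
      (mk⇔ to′ from′)))
      where
      After? = λ j → (i Fin.<? j) ×-dec nonempty? (J j)
      to′ : ∀ {j} → j List.∈ filter After? (allFin n) → j List.∈ filter (nonempty? ∘ J) rows
      to′ j∈ with i<j , eff ← proj₂ (∈-filter⁻ After? {xs = allFin n} j∈) with complete (here refl) i<j eff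
      ... | here refl = contradiction i<j (Fin.<-irrefl refl)
      ... | there j∈rows = ∈-filter⁺ (nonempty? ∘ J) j∈rows eff
      from′ : ∀ {j} → j List.∈ filter (nonempty? ∘ J) rows → j List.∈ filter After? (allFin n)
      from′ j∈ with j∈rows , eff ← ∈-filter⁻ (nonempty? ∘ J) {xs = rows} j∈ =
        ∈-filter⁺ After? (∈-allFin _) (All.lookup i<rows j∈rows , eff)

    rowsUpTo-complete : ∀ {r} → IsMaxEffective r → UpwardComplete (rowsUpTo r)
    rowsUpTo-complete {r} (_ , max) =
        AllPairs.filter⁺ (Fin._≤? r) (AllPairs.tabulate⁺-< id)
      , λ {_} {j} _ _ eff → ∈-filter⁺ (Fin._≤? r) (∈-allFin j) (≮⇒≥ (λ r<j → max j r<j eff))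

    2^#effective≤#switches : ∀ rows → 2 ^ #effective rows ≤ #switches rows
    2^#effective≤#switches []         = ≤-refl
    2^#effective≤#switches (i ∷ rows) with nonempty? (J i)
    ... | yes eff = *-mono-≤ (s≤s (Nonempty⇒1≤∣p∣ eff)) (2^#effective≤#switches rows)
    ... | no _    = ≤-trans (2^#effective≤#switches rows) (m≤n*m (#switches rows) (suc (c i)))

    -- S misses J i and also i, which is not in J i. So the inclusion of J i in the complement of S
    -- is strict, which accounts for the extra 1.
    disjoint⇒∣S∣+c<n : ∀ {i} (S : Subset n) → i ∉ S → ¬ Nonempty (J i ∩ S) → ∣ S ∣ ≤ n ∸ (c i + 1)
    disjoint⇒∣S∣+c<n {i} S i∉S disj = m+n≤o⇒m≤o∸n ∣ S ∣ (begin
      ∣ S ∣ + (c i + 1)    ≡⟨ cong (∣ S ∣ +_) (+-comm (c i) 1) ⟩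
      ∣ S ∣ + suc (c i)    ≤⟨ +-monoʳ-≤ ∣ S ∣ (p⊂q⇒∣p∣<∣q∣ J⊂∁S) ⟩
      ∣ S ∣ + ∣ ∁ S ∣      ≡⟨ cong (∣ S ∣ +_) (∣∁p∣≡n∸∣p∣ S) ⟩
      ∣ S ∣ + (n ∸ ∣ S ∣)  ≡⟨ m+[n∸m]≡n (∣p∣≤n S) ⟩
      n                    ∎)
      where
      open ≤-Reasoning
      J⊂∁S : J i ⊂ ∁ S
      J⊂∁S = (λ x∈J → x∉p⇒x∈∁p (λ x∈S → disj (_ , x∈p∩q⁺ (x∈J , x∈S)))) , i , x∉p⇒x∈∁p i∉S , i∉Ji

    -- Closed form: 2 ∏ (c i + 1) − 1.  It bounds the expected cost per element
    -- of the sets, even when every branch is followed in every row.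
    costWeight : List (Fin n) → ℕ
    costWeight []         = 1
    costWeight (i ∷ rows) = suc (c i) * costWeight rows + c i

    -- The cost of one step for a given pair of sets

    callCost : ℕ → Call n → ℕ
    callCost w (call e R R′) = e + ∣ R ∣ * w

    stepCost : ℕ → Fin n → Subset n → Subset n → ℕ
    stepCost w i S S′ = sum (map (callCost w) (step T i S S′))

    module _ (w : ℕ) {i : Fin n} {ℓ : ℕ} (S S′ : Subset n) (∣S∣≤ℓ : ∣ S ∣ ≤ ℓ) (∣S′∣≤ℓ : ∣ S′ ∣ ≤ ℓ) where
      open ≤-Reasoning

      -- `∣ ⁅ i ⁆ ∩ S′ ∣` is the indicator of the direct call and `∣ J i ∩ S′ ∣` the number of
      -- switched calls. Only the cardinalities are rounded up, from ℓ - 1 to ℓ; the dependence on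
      -- S′ is kept for averaging.
      stepCost-∈ : i ∈ S → stepCost w i S S′ ≤ ℓ * (∣ ⁅ i ⁆ ∩ S′ ∣ * w + ∣ J i ∩ S′ ∣ * (1 + w))
      stepCost-∈ i∈S with i ∈? S
      ... | no i∉S = contradiction i∈S i∉S
      ... | yes _ = begin
        sum (map (callCost w) (direct ++ switched))                      ≡⟨ cong sum (map-++ (callCost w) direct switched) ⟩
        sum (map (callCost w) direct ++ map (callCost w) switched)       ≡⟨ sum-++ (map (callCost w) direct) _ ⟩
        sum (map (callCost w) direct) + sum (map (callCost w) switched)  ≤⟨ +-mono-≤ direct≤ switched≤ ⟩
        ∣ ⁅ i ⁆ ∩ S′ ∣ * (ℓ * w) + ∣ J i ∩ S′ ∣ * (ℓ + ℓ * w)            ≡⟨ arith ∣ ⁅ i ⁆ ∩ S′ ∣ ∣ J i ∩ S′ ∣ ℓ w ⟩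
        ℓ * (∣ ⁅ i ⁆ ∩ S′ ∣ * w + ∣ J i ∩ S′ ∣ * (1 + w))                ∎
        where
        direct = if does (i ∈? S′) then [ call 0 (S - i) (S′ - i) ] else []
        toCall = λ j → call ∣ S′ - j ∣ (S - i) (image (σ i j) (S′ - j))
        switched = map toCall (elements (J i ∩ S′))
        ∣S-i∣≤ℓ = ≤-trans (∣p─q∣≤∣p∣ S ⁅ i ⁆) ∣S∣≤ℓ

        direct≤ : sum (map (callCost w) direct) ≤ ∣ ⁅ i ⁆ ∩ S′ ∣ * (ℓ * w)
        direct≤ with i ∈? S′
        ... | no _ = z≤n
        ... | yes i∈S′ = begin
          ∣ S - i ∣ * w + 0         ≡⟨ +-identityʳ _ ⟩
          ∣ S - i ∣ * w             ≤⟨ *-monoˡ-≤ w ∣S-i∣≤ℓ ⟩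
          ℓ * w                     ≡⟨ *-identityˡ _ ⟨
          1 * (ℓ * w)               ≤⟨ *-monoˡ-≤ (ℓ * w) (Nonempty⇒1≤∣p∣ (i , x∈p∩q⁺ (x∈⁅x⁆ i , i∈S′))) ⟩
          ∣ ⁅ i ⁆ ∩ S′ ∣ * (ℓ * w)  ∎

        switched≤ : sum (map (callCost w) switched) ≤ ∣ J i ∩ S′ ∣ * (ℓ + ℓ * w)
        switched≤ = begin
          sum (map (callCost w) switched)                        ≡⟨ cong sum (map-∘ (elements (J i ∩ S′))) ⟨
          sum (map (callCost w ∘ toCall) (elements (J i ∩ S′)))  ≤⟨ sum-map-≤ (elements (J i ∩ S′)) (λ j →
              +-mono-≤ (≤-trans (∣p─q∣≤∣p∣ S′ ⁅ j ⁆) ∣S′∣≤ℓ) (*-monoˡ-≤ w ∣S-i∣≤ℓ)) ⟩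
          length (elements (J i ∩ S′)) * (ℓ + ℓ * w)  ≡⟨ cong (_* (ℓ + ℓ * w)) (length-elements (J i ∩ S′)) ⟩
          ∣ J i ∩ S′ ∣ * (ℓ + ℓ * w)                  ∎

        arith : ∀ x y ℓ w → x * (ℓ * w) + y * (ℓ + ℓ * w) ≡ ℓ * (x * w + y * (1 + w))
        arith = ℕ-Solver.solve-∀

      stepCost-∉-blocked : i ∉ S → i ∈ S′ → stepCost w i S S′ ≡ 0
      stepCost-∉-blocked i∉S i∈S′ with i ∈? S | i ∈? S′
      ... | yes i∈S | _       = contradiction i∈S i∉S
      ... | no _    | yes _   = refl
      ... | no _    | no i∉S′ = contradiction i∈S′ i∉S′

      stepCost-∉-switch : i ∉ S → Nonempty (J i ∩ S′) → stepCost w i S S′ ≡ 0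
      stepCost-∉-switch i∉S ne with i ∈? S | i ∈? S′ | nonempty? (J i ∩ S′)
      ... | yes i∈S | _       | _     = contradiction i∈S i∉S
      ... | no _    | yes _   | _     = refl
      ... | no _    | no _    | yes _ = refl
      ... | no _    | no _    | no ¬p = contradiction ne ¬p

      stepCost-∉-≤ : i ∉ S → stepCost w i S S′ ≤ ℓ * (suc (c i) * w + c i)
      stepCost-∉-≤ i∉S with i ∈? S | i ∈? S′ | nonempty? (J i ∩ S′)
      ... | yes i∈S | _       | _     = contradiction i∈S i∉S
      ... | no _    | yes _   | _     = z≤n
      ... | no _    | no _    | yes _ = z≤n
      ... | no _    | no _    | no _  = begin
        ∣ S ∣ * w + sum (map (callCost w) (map toCall (elements (J i))))  ≡⟨ cong (∣ S ∣ * w +_) (cong sum (sym (map-∘ (elements (J i))))) ⟩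
        ∣ S ∣ * w + sum (map (callCost w ∘ toCall) (elements (J i)))
          ≤⟨ +-mono-≤ (*-monoˡ-≤ w ∣S∣≤ℓ) (sum-map-≤ (elements (J i)) (λ j → +-mono-≤ ∣S′∣≤ℓ (*-monoˡ-≤ w ∣S∣≤ℓ))) ⟩
        ℓ * w + length (elements (J i)) * (ℓ + ℓ * w)  ≡⟨ cong (λ x → ℓ * w + x * (ℓ + ℓ * w)) (length-elements (J i)) ⟩
        ℓ * w + c i * (ℓ + ℓ * w)                      ≡⟨ arith (c i) ℓ w ⟩
        ℓ * (suc (c i) * w + c i)                      ∎
        where
        toCall = λ j → call ∣ S′ ∣ S (image (σ i j) S′)
        arith : ∀ c ℓ w → ℓ * w + c * (ℓ + ℓ * w) ≡ ℓ * (suc c * w + c)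
        arith = ℕ-Solver.solve-∀

      stepCost-≤ : stepCost w i S S′ ≤ ℓ * (suc (c i) * w + c i)
      stepCost-≤ = case i ∈? S of λ where
          (no i∉S) → stepCost-∉-≤ i∉S
          (yes i∈S) → begin
            stepCost w i S S′                                  ≤⟨ stepCost-∈ i∈S ⟩
            ℓ * (∣ ⁅ i ⁆ ∩ S′ ∣ * w + ∣ J i ∩ S′ ∣ * (1 + w))  ≤⟨ *-monoʳ-≤ ℓ (+-mono-≤
                (*-monoˡ-≤ w (≤-trans (∣p∩q∣≤∣p∣ ⁅ i ⁆ S′) (≤-reflexive (∣⁅x⁆∣≡1 i)))) (*-monoˡ-≤ (1 + w) (∣p∩q∣≤∣p∣ (J i) S′))) ⟩
            ℓ * (1 * w + c i * (1 + w))  ≡⟨ arith (c i) ℓ w ⟩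
            ℓ * (suc (c i) * w + c i)    ∎
        where
        arith : ∀ c ℓ w → ℓ * (1 * w + c * (1 + w)) ≡ ℓ * (suc c * w + c)
        arith = ℕ-Solver.solve-∀

      -- When S′ is too large to avoid i and J i, only the element branch costs anything.
      stepCost-large-≤ : n ∸ (c i + 1) < ∣ S′ ∣ →
        stepCost w i S S′ ≤ ∣ ⁅ i ⁆ ∩ S ∣ * (ℓ * (∣ ⁅ i ⁆ ∩ S′ ∣ * w + ∣ J i ∩ S′ ∣ * (1 + w)))
      stepCost-large-≤ large = case i ∈? S of λ where
          -- `∣ ⁅ i ⁆ ∩ S ∣` serves as the indicator of i ∈ S. It makes the bound a product of a
          -- term in S and a term in S′.
          (yes i∈S) → ≤-trans (stepCost-∈ i∈S) (≤-trans (≤-reflexive (sym (*-identityˡ _)))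
                        (*-monoˡ-≤ _ (Nonempty⇒1≤∣p∣ (i , x∈p∩q⁺ (x∈⁅x⁆ i , i∈S)))))
          (no i∉S) → ≤-trans (≤-reflexive (stepCost≡0 i∉S)) z≤n
        where
        stepCost≡0 : i ∉ S → stepCost w i S S′ ≡ 0
        stepCost≡0 i∉S = case i ∈? S′ of λ where
          (yes i∈S′) → stepCost-∉-blocked i∉S i∈S′
          (no i∉S′) → case nonempty? (J i ∩ S′) of λ where
            (yes ne) → stepCost-∉-switch i∉S ne
            (no ¬ne) → contradiction (disjoint⇒∣S∣+c<n S′ i∉S′ ¬ne) (<⇒≱ large)

open Switches

import Data.Integer.Base as ℤ
import Data.Integer.Properties as ℤ
open import Data.List.Membership.Propositional using (_∈_)
open import Data.Nat.Properties using (<-trans)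
open import Data.Rational.Base using (ℚ; 0ℚ; 1ℚ; _+_; _*_; _≤_; _/_; nonNegative; toℚᵘ)
open import Data.Rational.Properties as ℚ hiding (_≟_; <-trans; ≰⇒>)
open import Data.Rational.Solver using (module +-*-Solver)
open +-*-Solver using (solve; _:=_; _:*_; _:+_; con)
open import Data.Rational.Unnormalised.Base as ℚᵘ using (mkℚᵘ; *≡*)
import Data.Rational.Unnormalised.Properties as ℚᵘ

-- Natural numbers in the rationals, quotients, sums and means

toℚᵘ-fromℕ : ∀ a → toℚᵘ (fromℕ a) ℚᵘ.≃ mkℚᵘ (ℤ.+ a) 0
toℚᵘ-fromℕ a = toℚᵘ-fromℚᵘ (mkℚᵘ (ℤ.+ a) 0)

-- Checked on unnormalised representatives, where equality is cross-multiplication. The normalised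
-- quotient is reduced by a gcd, which does not compute on variables.
fromℕ-homo-+ : ∀ a b → fromℕ (a ℕ.+ b) ≡ fromℕ a + fromℕ b
fromℕ-homo-+ a b = toℚᵘ-injective (begin
  toℚᵘ (fromℕ (a ℕ.+ b))              ≈⟨ toℚᵘ-fromℕ (a ℕ.+ b) ⟩
  mkℚᵘ (ℤ.+ (a ℕ.+ b)) 0              ≈⟨ *≡* (cong (λ x → ℤ.+ x ℤ.* ℤ.+ 1) (sym (cong₂ ℕ._+_ (ℕ.*-identityʳ a) (ℕ.*-identityʳ b)))) ⟩
  mkℚᵘ (ℤ.+ (a ℕ.* 1 ℕ.+ b ℕ.* 1)) 0  ≈⟨ *≡* (cong (ℤ._* ℤ.+ 1) (cong₂ ℤ._+_ (ℤ.pos-* a 1) (ℤ.pos-* b 1))) ⟩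
  mkℚᵘ (ℤ.+ a) 0 ℚᵘ.+ mkℚᵘ (ℤ.+ b) 0  ≈⟨ ℚᵘ.+-cong (toℚᵘ-fromℕ a) (toℚᵘ-fromℕ b) ⟨
  toℚᵘ (fromℕ a) ℚᵘ.+ toℚᵘ (fromℕ b)  ≈⟨ toℚᵘ-homo-+ (fromℕ a) (fromℕ b) ⟨
  toℚᵘ (fromℕ a + fromℕ b)            ∎)
  where open ℚᵘ.≃-Reasoning

fromℕ-homo-* : ∀ a b → fromℕ (a ℕ.* b) ≡ fromℕ a * fromℕ b
fromℕ-homo-* a b = toℚᵘ-injective (begin
  toℚᵘ (fromℕ (a ℕ.* b))              ≈⟨ toℚᵘ-fromℕ (a ℕ.* b) ⟩
  mkℚᵘ (ℤ.+ (a ℕ.* b)) 0              ≈⟨ *≡* (cong (ℤ._* ℤ.+ 1) (ℤ.pos-* a b)) ⟩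
  mkℚᵘ (ℤ.+ a) 0 ℚᵘ.* mkℚᵘ (ℤ.+ b) 0  ≈⟨ ℚᵘ.*-cong (toℚᵘ-fromℕ a) (toℚᵘ-fromℕ b) ⟨
  toℚᵘ (fromℕ a) ℚᵘ.* toℚᵘ (fromℕ b)  ≈⟨ toℚᵘ-homo-* (fromℕ a) (fromℕ b) ⟨
  toℚᵘ (fromℕ a * fromℕ b)            ∎)
  where open ℚᵘ.≃-Reasoning

1/n*n≡1 : ∀ n → (ℤ.+ 1 / suc n) * fromℕ (suc n) ≡ 1ℚ
1/n*n≡1 n = toℚᵘ-injective (begin
  toℚᵘ ((ℤ.+ 1 / suc n) * fromℕ (suc n))          ≈⟨ toℚᵘ-homo-* (ℤ.+ 1 / suc n) (fromℕ (suc n)) ⟩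
  toℚᵘ (ℤ.+ 1 / suc n) ℚᵘ.* toℚᵘ (fromℕ (suc n))  ≈⟨ ℚᵘ.*-cong (toℚᵘ-fromℚᵘ (mkℚᵘ (ℤ.+ 1) n)) (toℚᵘ-fromℕ (suc n)) ⟩
  mkℚᵘ (ℤ.+ 1) n ℚᵘ.* mkℚᵘ (ℤ.+ suc n) 0          ≈⟨ *≡* (trans (trans (ℤ.*-identityʳ _) (ℤ.*-identityˡ _)) (sym (trans (ℤ.*-identityˡ _) (cong ℤ.+_ (ℕ.*-identityʳ (suc n)))))) ⟩
  toℚᵘ 1ℚ                                         ∎)
  where open ℚᵘ.≃-Reasoning

0≤fromℕ : ∀ a → 0ℚ ≤ fromℕ a
0≤fromℕ a = nonNegative⁻¹ (fromℕ a) {{ℚ.normalize-nonNeg a 1}}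

fromℕ-mono-≤ : ∀ {a b} → a ℕ.≤ b → fromℕ a ≤ fromℕ b
fromℕ-mono-≤ {a} {b} a≤b = begin
  fromℕ a                    ≡⟨ ℚ.+-identityʳ (fromℕ a) ⟨
  fromℕ a + 0ℚ               ≤⟨ ℚ.+-monoʳ-≤ (fromℕ a) (0≤fromℕ (b ℕ.∸ a)) ⟩
  fromℕ a + fromℕ (b ℕ.∸ a)  ≡⟨ fromℕ-homo-+ a (b ℕ.∸ a) ⟨
  fromℕ (a ℕ.+ (b ℕ.∸ a))    ≡⟨ cong fromℕ (ℕ.m+[n∸m]≡n a≤b) ⟩
  fromℕ b                    ∎
  where open ≤-Reasoning

*-nonNeg : ∀ {p q} → 0ℚ ≤ p → 0ℚ ≤ q → 0ℚ ≤ p * q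
*-nonNeg {p} {q} 0≤p 0≤q = nonNegative⁻¹ (p * q)
  {{nonNeg*nonNeg⇒nonNeg p {{nonNegative 0≤p}} q {{nonNegative 0≤q}}}}

/ℕ-*-cancel : ∀ q d .{{_ : ℕ.NonZero d}} → (q /ℕ d) * fromℕ d ≡ q
/ℕ-*-cancel q (suc d) = begin
  q * (ℤ.+ 1 / suc d) * fromℕ (suc d)    ≡⟨ ℚ.*-assoc q (ℤ.+ 1 / suc d) (fromℕ (suc d)) ⟩
  q * ((ℤ.+ 1 / suc d) * fromℕ (suc d))  ≡⟨ cong (q *_) (1/n*n≡1 d) ⟩
  q * 1ℚ                                 ≡⟨ ℚ.*-identityʳ q ⟩
  q                                      ∎
  where open ≡-Reasoning

*-/ℕ-cancel : ∀ q d .{{_ : ℕ.NonZero d}} → (q * fromℕ d) /ℕ d ≡ q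
*-/ℕ-cancel q (suc d) = begin
  q * fromℕ (suc d) * (ℤ.+ 1 / suc d)    ≡⟨ ℚ.*-assoc q (fromℕ (suc d)) (ℤ.+ 1 / suc d) ⟩
  q * (fromℕ (suc d) * (ℤ.+ 1 / suc d))  ≡⟨ cong (q *_) (trans (ℚ.*-comm (fromℕ (suc d)) (ℤ.+ 1 / suc d)) (1/n*n≡1 d)) ⟩
  q * 1ℚ                                 ≡⟨ ℚ.*-identityʳ q ⟩
  q                                      ∎
  where open ≡-Reasoning

/ℕ-monoˡ-≤ : ∀ {p q} d → p ≤ q → p /ℕ d ≤ q /ℕ d
/ℕ-monoˡ-≤ zero    p≤q = ≤-refl
/ℕ-monoˡ-≤ (suc d) p≤q = *-monoʳ-≤-nonNeg (ℤ.+ 1 / suc d) {{ℚ.normalize-nonNeg 1 (suc d)}} p≤q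

/ℕ-nonNeg : ∀ {q} d → 0ℚ ≤ q → 0ℚ ≤ q /ℕ d
/ℕ-nonNeg zero        0≤q = ≤-refl
/ℕ-nonNeg {q} (suc d) 0≤q = ≤-trans (≤-reflexive (sym (ℚ.*-zeroˡ (ℤ.+ 1 / suc d)))) (/ℕ-monoˡ-≤ (suc d) 0≤q)

-- The condition 0 ≤ p settles d = 0, where the quotient is 0 by convention. Means over empty lists
-- are thereby included in `mean≤`.
≤*⇒/ℕ≤ : ∀ {p q} d → 0ℚ ≤ p → q ≤ p * fromℕ d → q /ℕ d ≤ p
≤*⇒/ℕ≤     zero    0≤p q≤pd = 0≤p
≤*⇒/ℕ≤ {p} (suc d) 0≤p q≤pd = ≤-trans (/ℕ-monoˡ-≤ (suc d) q≤pd) (≤-reflexive (*-/ℕ-cancel p (suc d)))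

∑-mono-≤ : ∀ {a} {A : Set a} (xs : List A) {f g : A → ℚ} →
           (∀ {x} → x ∈ xs → f x ≤ g x) → ∑ xs f ≤ ∑ xs g
∑-mono-≤ []       f≤g = ≤-refl
∑-mono-≤ (x ∷ xs) f≤g = +-mono-≤ (f≤g (here refl)) (∑-mono-≤ xs (λ x∈ → f≤g (there x∈)))

∑-nonNeg : ∀ {a} {A : Set a} (xs : List A) {f : A → ℚ} → (∀ x → 0ℚ ≤ f x) → 0ℚ ≤ ∑ xs f
∑-nonNeg []       0≤f = ≤-refl
∑-nonNeg (x ∷ xs) 0≤f = +-mono-≤ (0≤f x) (∑-nonNeg xs 0≤f)

if-≤ : ∀ b {p q r : ℚ} → p ≤ r → q ≤ r → (if b then p else q) ≤ r
if-≤ true  p≤r q≤r = p≤r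
if-≤ false p≤r q≤r = q≤r

∑-fromℕ : ∀ {a} {A : Set a} (xs : List A) (f : A → ℕ) →
          ∑ xs (fromℕ ∘ f) ≡ fromℕ (sum (map f xs))
∑-fromℕ []       f = refl
∑-fromℕ (x ∷ xs) f = trans (cong (fromℕ (f x) +_) (∑-fromℕ xs f)) (sym (fromℕ-homo-+ (f x) _))

∑≤fromℕ-sum : ∀ {a} {A : Set a} (xs : List A) {f : A → ℚ} {g : A → ℕ} →
              (∀ {x} → x ∈ xs → f x ≤ fromℕ (g x)) → ∑ xs f ≤ fromℕ (sum (map g xs))
∑≤fromℕ-sum xs {g = g} f≤g = ≤-trans (∑-mono-≤ xs f≤g) (≤-reflexive (∑-fromℕ xs g))

mean≤ : ∀ {a} {A : Set a} (xs : List A) {f : A → ℚ} {q} → 0ℚ ≤ q →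
        ∑ xs f ≤ q * fromℕ (length xs) → mean xs f ≤ q
mean≤ xs = ≤*⇒/ℕ≤ (length xs)

∈-subsetsFrom⇒∣S∣≡ : ∀ {n} (i : Fin n) {ℓ S} → S ∈ subsetsFrom i ℓ → ∣ S ∣ ≡ ℓ
∈-subsetsFrom⇒∣S∣≡ {n} i {ℓ} S∈ =
  proj₂ (proj₂ (∈-filter⁻ (λ S → (S ⊆? from i) ×-dec (∣ S ∣ ℕ.≟ ℓ)) {xs = allSubsets n} S∈))

-- The trivial bound on the expected cost

module _ {n p} {G : Subgroup n p} (T : SwitchTable G) where
  open SwitchTable T

  branchCost : List (Fin n) → Fin n → Subset n × Subset n → ℚ
  branchCost rows i (S , S′) =
    ∑ (step T i S S′) (λ (call e R R′) → fromℕ e + expectedCost T rows ∣ R ∣)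

  branchCost≤ : ∀ rows → (∀ ℓ → expectedCost T rows ℓ ≤ fromℕ (ℓ ℕ.* costWeight T rows)) → ∀ i S S′ →
             branchCost rows i (S , S′) ≤ fromℕ (stepCost T (costWeight T rows) i S S′)
  branchCost≤ rows ih i S S′ = ∑≤fromℕ-sum (step T i S S′) {g = callCost T (costWeight T rows)} (λ {(call e R R′)} _ →
    ≤-trans (+-monoʳ-≤ (fromℕ e) (ih ∣ R ∣)) (≤-reflexive (sym (fromℕ-homo-+ e (∣ R ∣ ℕ.* costWeight T rows)))))

  -- The bound holds for every single pair of sets, hence for the mean. It is proved for all ℓ at
  -- once because the element branch lowers the cardinality.
  expectedCost≤ : ∀ rows ℓ → expectedCost T rows ℓ ≤ fromℕ (ℓ ℕ.* costWeight T rows)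
  expectedCost≤ []         ℓ = ≤-reflexive (cong fromℕ (sym (ℕ.*-identityʳ ℓ)))
  expectedCost≤ (i ∷ rows) ℓ = if-≤ _ (0≤fromℕ bound) (mean≤ pairs {branchCost rows i} (0≤fromℕ bound) (begin
    ∑ pairs (branchCost rows i)  ≤⟨ ∑≤fromℕ-sum pairs (λ {(S , S′)} SS′∈ →
        let (S∈ , S′∈) = ∈-cartesianProduct⁻ (subsetsFrom i ℓ) (subsetsFrom i ℓ) SS′∈ in
        ≤-trans (branchCost≤ rows (expectedCost≤ rows) i S S′)
                (fromℕ-mono-≤ (stepCost-≤ T (costWeight T rows) {i} S S′ (ℕ.≤-reflexive (∈-subsetsFrom⇒∣S∣≡ i S∈)) (ℕ.≤-reflexive (∈-subsetsFrom⇒∣S∣≡ i S′∈))))) ⟩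
    fromℕ (sum (map (λ _ → bound) pairs))  ≡⟨ cong fromℕ (sum-map-const pairs (λ _ → refl)) ⟩
    fromℕ (length pairs ℕ.* bound)         ≡⟨ cong fromℕ (ℕ.*-comm (length pairs) bound) ⟩
    fromℕ (bound ℕ.* length pairs)         ≡⟨ fromℕ-homo-* bound (length pairs) ⟩
    fromℕ bound * fromℕ (length pairs)     ∎))
    where
    open ≤-Reasoning
    bound = ℓ ℕ.* costWeight T (i ∷ rows)
    pairs = cartesianProduct (subsetsFrom i ℓ) (subsetsFrom i ℓ)

-- The first row and the factor ρ₁(m)²

subsetsFrom-zero : ∀ n ℓ → subsetsFrom {suc n} zero ℓ ≡ ksubsets (suc n) ℓ
subsetsFrom-zero n ℓ = filter-≐ (λ S → (S ⊆? from zero) ×-dec (∣ S ∣ ℕ.≟ ℓ)) (λ S → ∣ S ∣ ℕ.≟ ℓ)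
  (proj₂ , λ ∣S∣≡ℓ → (λ _ → ∈-tabulate-does⁺ (λ j → Fin.zero {n} Fin.≤? j) z≤n) , ∣S∣≡ℓ) (allSubsets (suc n))

ρ-zero : ∀ {n m} → 0 < m → m < suc n → ρ {suc n} zero m ≡ fromℕ m /ℕ suc n
ρ-zero {n} {m} 0<m m<n = cong (λ b → if b then fromℕ m /ℕ suc n else 0ℚ)
  (dec-true ((0 ℕ.<? m) ×-dec (m ℕ.<? suc n)) (0<m , m<n))

-- The absorption identity divided by n + 1: the share of the (ℓ + 1)-subsets that contain a given
-- point. This is how ρ₁ enters.
length-ksubsets-ρ : ∀ n ℓ → fromℕ (length (ksubsets n ℓ)) ≡
                    fromℕ (suc ℓ) /ℕ suc n * fromℕ (length (ksubsets (suc n) (suc ℓ)))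
length-ksubsets-ρ n ℓ = begin
  fromℕ a                           ≡⟨ *-/ℕ-cancel (fromℕ a) (suc n) ⟨
  fromℕ a * fromℕ (suc n) /ℕ suc n  ≡⟨ cong (_/ℕ suc n) (begin
      fromℕ a * fromℕ (suc n)       ≡⟨ fromℕ-homo-* a (suc n) ⟨
      fromℕ (a ℕ.* suc n)           ≡⟨ cong fromℕ (trans (ℕ.*-comm a (suc n)) (length-ksubsets-absorption n ℓ)) ⟩
      fromℕ (suc ℓ ℕ.* b)           ≡⟨ fromℕ-homo-* (suc ℓ) b ⟩
      fromℕ (suc ℓ) * fromℕ b       ≡⟨ cong (_* fromℕ b) (/ℕ-*-cancel (fromℕ (suc ℓ)) (suc n)) ⟨
      ρ′ * fromℕ (suc n) * fromℕ b  ≡⟨ solve 3 (λ x y z → x :* y :* z := x :* z :* y) refl ρ′ (fromℕ (suc n)) (fromℕ b) ⟩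
      ρ′ * fromℕ b * fromℕ (suc n)  ∎) ⟩
  ρ′ * fromℕ b * fromℕ (suc n) /ℕ suc n  ≡⟨ *-/ℕ-cancel (ρ′ * fromℕ b) (suc n) ⟩
  ρ′ * fromℕ b                           ∎
  where
  open ≡-Reasoning
  a = length (ksubsets n ℓ)
  b = length (ksubsets (suc n) (suc ℓ))
  ρ′ = fromℕ (suc ℓ) /ℕ suc n

module _ {n p} {G : Subgroup (suc n) p} (T : SwitchTable G) where
  open SwitchTable T

  private
    module FirstRow (w ℓ : ℕ) where
      m = suc ℓ
      L = subsetsFrom {suc n} zero m
      -- The number of m-subsets of all n + 1 points that contain a given point.
      a = length (ksubsets n ℓ)
      bound = m ℕ.* (suc (c zero) ℕ.* w ℕ.+ c zero)

      f g : Subset (suc n) → ℕ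
      f S  = ∣ ⁅ zero ⁆ ∩ S ∣
      g S′ = m ℕ.* (∣ ⁅ zero ⁆ ∩ S′ ∣ ℕ.* w ℕ.+ ∣ J zero ∩ S′ ∣ ℕ.* suc w)

      sum-∩ : ∀ K → sum (map (λ S → ∣ K ∩ S ∣) L) ≡ ∣ K ∣ ℕ.* a
      sum-∩ K = trans (cong (λ xs → sum (map (λ S → ∣ K ∩ S ∣) xs)) (subsetsFrom-zero n m)) (∑∣∩∣-suc K ℓ)

      sum-f : sum (map f L) ≡ a
      sum-f = trans (sum-∩ ⁅ zero {n} ⁆) (trans (cong (ℕ._* a) (∣⁅x⁆∣≡1 (zero {n}))) (ℕ.*-identityˡ a))

      sum-g : sum (map g L) ≡ m ℕ.* (a ℕ.* w ℕ.+ c zero ℕ.* a ℕ.* suc w)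
      sum-g = trans (sum-map-*ˡ m L _) (cong (m ℕ.*_) (trans (sum-map-+ L _ _) (cong₂ ℕ._+_
        (trans (sum-map-*ʳ w L f) (cong (ℕ._* w) sum-f))
        (trans (sum-map-*ʳ (suc w) L _) (cong (ℕ._* suc w) (sum-∩ (J zero)))))))

      arith : ∀ a m w c → a ℕ.* (m ℕ.* (a ℕ.* w ℕ.+ c ℕ.* a ℕ.* suc w)) ≡ a ℕ.* a ℕ.* (m ℕ.* (suc c ℕ.* w ℕ.+ c))
      arith = ℕ-Solver.solve-∀

      -- Each of the two sums carries one factor a, so the trivial bound is counted a² times. There
      -- are b² pairs, where b is the number of m-subsets, and a/b is the density m/(n + 1).
      sum-f*g : sum (map (λ (S , S′) → f S ℕ.* g S′) (cartesianProduct L L)) ≡ a ℕ.* a ℕ.* bound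
      sum-f*g = trans (sum-cartesianProduct f g L L) (trans (cong₂ ℕ._*_ sum-f sum-g) (arith a m w (c zero)))

  private
    firstRow-/ℕ≤ : ∀ rows ℓ → suc n ℕ.∸ (c zero ℕ.+ 1) < suc ℓ →
      expectedCost T (zero ∷ rows) (suc ℓ) ≤
        (fromℕ (suc ℓ) /ℕ suc n) ² * fromℕ (suc ℓ ℕ.* costWeight T (zero ∷ rows))
    firstRow-/ℕ≤ rows ℓ large = if-≤ _ 0≤q (mean≤ pairs {branchCost T rows zero} 0≤q (begin
      ∑ pairs (branchCost T rows zero)                     ≤⟨ ∑≤fromℕ-sum pairs branch≤ ⟩
      fromℕ (sum (map (λ (S , S′) → f S ℕ.* g S′) pairs))  ≡⟨ cong fromℕ sum-f*g ⟩
      fromℕ (a ℕ.* a ℕ.* bound)                            ≡⟨ fromℕ-homo-* (a ℕ.* a) bound ⟩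
      fromℕ (a ℕ.* a) * fromℕ bound                        ≡⟨ cong (_* fromℕ bound) (fromℕ-homo-* a a) ⟩
      fromℕ a * fromℕ a * fromℕ bound                      ≡⟨ cong (λ x → x * x * fromℕ bound) (length-ksubsets-ρ n ℓ) ⟩
      q * fromℕ b * (q * fromℕ b) * fromℕ bound            ≡⟨ rearrange q (fromℕ b) (fromℕ bound) ⟩
      q ² * fromℕ bound * (fromℕ b * fromℕ b)              ≡⟨ cong (q ² * fromℕ bound *_) length-pairs ⟨
      q ² * fromℕ bound * fromℕ (length pairs)             ∎))
      where
      open ≤-Reasoning
      w = costWeight T rows
      open FirstRow w ℓ
      pairs = cartesianProduct L L
      b = length (ksubsets (suc n) (suc ℓ))
      q = fromℕ (suc ℓ) /ℕ suc n
      0≤q′ = /ℕ-nonNeg (suc n) (0≤fromℕ (suc ℓ))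
      0≤q = *-nonNeg (*-nonNeg 0≤q′ 0≤q′) (0≤fromℕ bound)

      rearrange : ∀ r b x → r * b * (r * b) * x ≡ r * r * x * (b * b)
      rearrange = solve 3 (λ r b x → r :* b :* (r :* b) :* x := r :* r :* x :* (b :* b)) refl

      length-pairs : fromℕ (length pairs) ≡ fromℕ b * fromℕ b
      length-pairs = trans (cong fromℕ (trans (length-cartesianProduct L L)
        (cong (λ xs → length xs ℕ.* length xs) (subsetsFrom-zero n (suc ℓ))))) (fromℕ-homo-* b b)

      step≤ : ∀ {S S′} → S ∈ L → S′ ∈ L → stepCost T w zero S S′ ℕ.≤ f S ℕ.* g S′
      step≤ {S} {S′} S∈ S′∈ = stepCost-large-≤ T w S S′ (ℕ.≤-reflexive (∈-subsetsFrom⇒∣S∣≡ zero S∈))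
        (ℕ.≤-reflexive ∣S′∣≡m) (subst (suc n ℕ.∸ (c zero ℕ.+ 1) <_) (sym ∣S′∣≡m) large)
        where ∣S′∣≡m = ∈-subsetsFrom⇒∣S∣≡ zero S′∈

      branch≤ : ∀ {SS′} → SS′ ∈ pairs → branchCost T rows zero SS′ ≤ fromℕ (f (proj₁ SS′) ℕ.* g (proj₂ SS′))
      branch≤ {S , S′} SS′∈ = ≤-trans (branchCost≤ T rows (expectedCost≤ T rows) zero S S′)
          (fromℕ-mono-≤ {stepCost T w zero S S′} {f S ℕ.* g S′} (step≤ (proj₁ ∈²) (proj₂ ∈²)))
        where ∈² = ∈-cartesianProduct⁻ L L SS′∈

  firstRow≤ : ∀ rows {m} → 0 < m → m < suc n → suc n ℕ.∸ (c zero ℕ.+ 1) < m →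
              expectedCost T (zero ∷ rows) m ≤ ρ {suc n} zero m ² * fromℕ (m ℕ.* costWeight T (zero ∷ rows))
  firstRow≤ rows {suc ℓ} 0<m m<n large = ≤-trans
    (firstRow-/ℕ≤ rows ℓ large)
    (≤-reflexive (cong (λ q → q ² * fromℕ (suc ℓ ℕ.* costWeight T (zero ∷ rows))) (sym (ρ-zero 0<m m<n))))

-- The bound factor and the transitivity gap

1≤nPk : ∀ {n k} → k ℕ.≤ n → 1 ℕ.≤ n P k
1≤nPk {n} {k} k≤n = ℕ.≤-trans
  (m≥n⇒m/n>0 {{(n ∸ k) ℕ.!≢0}} (∣⇒≤ {{n ℕ.!≢0}} (m≤n⇒m!∣n! (ℕ.m∸n≤m n k))))
  (ℕ.≤-reflexive (sym (nPk≡n!/[n∸k]! k≤n)))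

1/2d : ∀ d .{{_ : ℕ.NonZero d}} → fromℕ 2 * (1ℚ /ℕ (2 ℕ.* d)) ≡ 1ℚ /ℕ d
1/2d d = begin
  fromℕ 2 * h                     ≡⟨ *-/ℕ-cancel (fromℕ 2 * h) d ⟨
  (fromℕ 2 * h * fromℕ d) /ℕ d    ≡⟨ cong (_/ℕ d) (solve 3 (λ x y z → x :* y :* z := y :* (x :* z)) refl (fromℕ 2) h (fromℕ d)) ⟩
  (h * (fromℕ 2 * fromℕ d)) /ℕ d  ≡⟨ cong (λ x → (h * x) /ℕ d) (fromℕ-homo-* 2 d) ⟨
  (h * fromℕ (2 ℕ.* d)) /ℕ d      ≡⟨ cong (_/ℕ d) (/ℕ-*-cancel 1ℚ (2 ℕ.* d) {{ℕ.m*n≢0 2 d}}) ⟩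
  1ℚ /ℕ d                         ∎
  where
  open ≡-Reasoning
  h = 1ℚ /ℕ (2 ℕ.* d)

module _ {n p} {G : Subgroup n p} (T : SwitchTable G) where
  open SwitchTable T

  boundTerm : Fin n → ℚ
  boundTerm j = (1ℚ /ℕ (2 ^ effectiveAfter j)) * (fromℕ (c j) /ℕ (c j ℕ.+ 1))

  0≤boundTerm : ∀ j → 0ℚ ≤ boundTerm j
  0≤boundTerm j = *-nonNeg (/ℕ-nonNeg (2 ^ effectiveAfter j) (0≤fromℕ 1)) (/ℕ-nonNeg (c j ℕ.+ 1) (0≤fromℕ (c j)))

  -- Write c as (c + 1) · c/(c + 1) and insert K/2^r(i), which is at least 1.
  c≤[1+c]*K*boundTerm : ∀ {i K} → 2 ^ effectiveAfter i ℕ.≤ K → fromℕ (c i) ≤ fromℕ (suc (c i) ℕ.* K) * boundTerm i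
  c≤[1+c]*K*boundTerm {i} {K} 2^e≤K = begin
    fromℕ (c i)                ≡⟨ ℚ.*-identityˡ (fromℕ (c i)) ⟨
    1ℚ * fromℕ (c i)           ≤⟨ *-monoʳ-≤-nonNeg (fromℕ (c i)) {{nonNegative (0≤fromℕ (c i))}} 1≤h*K ⟩
    h * fromℕ K * fromℕ (c i)  ≡⟨ cong (h * fromℕ K *_) (/ℕ-*-cancel (fromℕ (c i)) (c i ℕ.+ 1) {{c+1≢0}}) ⟨
    h * fromℕ K * (s * fromℕ (c i ℕ.+ 1)) ≡⟨ cong (λ x → h * fromℕ K * (s * fromℕ x)) (ℕ.+-comm (c i) 1) ⟩
    h * fromℕ K * (s * fromℕ (suc (c i))) ≡⟨ arith h (fromℕ K) s (fromℕ (suc (c i))) ⟩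
    fromℕ (suc (c i)) * fromℕ K * (h * s) ≡⟨ cong (_* (h * s)) (fromℕ-homo-* (suc (c i)) K) ⟨
    fromℕ (suc (c i) ℕ.* K) * (h * s)  ∎
    where
    open ≤-Reasoning
    h = 1ℚ /ℕ (2 ^ effectiveAfter i)
    s = fromℕ (c i) /ℕ (c i ℕ.+ 1)
    c+1≢0 = ℕ.>-nonZero (ℕ.m≤n+m 1 (c i))
    arith : ∀ h K s d → h * K * (s * d) ≡ d * K * (h * s)
    arith = solve 4 (λ h K s d → h :* K :* (s :* d) := d :* K :* (h :* s)) refl
    1≤h*K : 1ℚ ≤ h * fromℕ K
    1≤h*K = ≤-trans
      (≤-reflexive (sym (/ℕ-*-cancel 1ℚ (2 ^ effectiveAfter i) {{ℕ.m^n≢0 2 (effectiveAfter i)}})))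
      (*-monoˡ-≤-nonNeg h {{nonNegative (/ℕ-nonNeg (2 ^ effectiveAfter i) (0≤fromℕ 1))}} (fromℕ-mono-≤ 2^e≤K))

  -- A row turns the weight W into (c + 1) W + c. Multiplication by c + 1 is absorbed by the product
  -- of the switch numbers, and the added c is paid for by the new term of the sum.
  costWeight≤ : ∀ rows → UpwardComplete T rows →
                fromℕ (costWeight T rows) ≤ fromℕ (#switches T rows) * (1ℚ + ∑ rows boundTerm)
  costWeight≤ []         _        = ≤-refl
  costWeight≤ (i ∷ rows) complete = begin
    fromℕ (suc (c i) ℕ.* W ℕ.+ c i)        ≡⟨ fromℕ-homo-+ (suc (c i) ℕ.* W) (c i) ⟩
    fromℕ (suc (c i) ℕ.* W) + fromℕ (c i)  ≡⟨ cong (_+ fromℕ (c i)) (fromℕ-homo-* (suc (c i)) W) ⟩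
    d * fromℕ W + fromℕ (c i)              ≤⟨ +-mono-≤
        (*-monoˡ-≤-nonNeg d {{nonNegative (0≤fromℕ (suc (c i)))}} (costWeight≤ rows (tail-complete T complete)))
        (c≤[1+c]*K*boundTerm {i} {K} (ℕ.≤-trans (ℕ.≤-reflexive (cong (2 ^_) (effectiveAfter≡ T complete))) (2^#effective≤#switches T rows))) ⟩
    d * (fromℕ K * (1ℚ + Σ)) + fromℕ (suc (c i) ℕ.* K) * boundTerm i  ≡⟨ cong (λ x → d * (fromℕ K * (1ℚ + Σ)) + x * boundTerm i) (fromℕ-homo-* (suc (c i)) K) ⟩
    d * (fromℕ K * (1ℚ + Σ)) + d * fromℕ K * boundTerm i              ≡⟨ arith d (fromℕ K) 1ℚ Σ (boundTerm i) ⟩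
    d * fromℕ K * (1ℚ + (boundTerm i + Σ))                            ≡⟨ cong (_* (1ℚ + (boundTerm i + Σ))) (fromℕ-homo-* (suc (c i)) K) ⟨
    fromℕ (suc (c i) ℕ.* K) * (1ℚ + (boundTerm i + Σ))                ∎
    where
    open ≤-Reasoning
    W = costWeight T rows
    K = #switches T rows
    d = fromℕ (suc (c i))
    Σ = ∑ rows boundTerm
    arith : ∀ d K e s t → d * (K * (e + s)) + d * K * t ≡ d * K * (e + (t + s))
    arith = solve 5 (λ d K e s t → d :* (K :* (e :+ s)) :+ d :* K :* t := d :* K :* (e :+ (t :+ s))) refl

  boundTerm≤ : ∀ j → boundTerm j ≤ 1ℚ /ℕ (2 ^ effectiveAfter j)
  boundTerm≤ j = begin
    h * (fromℕ (c j) /ℕ (c j ℕ.+ 1))  ≤⟨ *-monoˡ-≤-nonNeg h {{nonNegative (/ℕ-nonNeg (2 ^ effectiveAfter j) (0≤fromℕ 1))}}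
        (≤*⇒/ℕ≤ (c j ℕ.+ 1) (0≤fromℕ 1) (≤-trans (fromℕ-mono-≤ (ℕ.m≤m+n (c j) 1)) (≤-reflexive (sym (ℚ.*-identityˡ (fromℕ (c j ℕ.+ 1))))))) ⟩
    h * 1ℚ  ≡⟨ ℚ.*-identityʳ h ⟩
    h       ∎
    where
    open ≤-Reasoning
    h = 1ℚ /ℕ (2 ^ effectiveAfter j)

  boundTerm≡0 : ∀ {j} → ¬ Effective j → boundTerm j ≡ 0ℚ
  boundTerm≡0 {j} ¬eff = trans (cong (λ x → h * (fromℕ x /ℕ (x ℕ.+ 1))) (trans (cong ∣_∣ (Empty-unique ¬eff)) (∣⊥∣≡0 n)))
    (ℚ.*-zeroʳ h)
    where h = 1ℚ /ℕ (2 ^ effectiveAfter j)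

  -- The e effective rows contribute at most 1/2^(e−1), …, 1/2, 1, which sum to 2 − 2/2^e.
  ∑boundTerm≤ : ∀ rows → UpwardComplete T rows → ∑ rows boundTerm + fromℕ 2 * (1ℚ /ℕ (2 ^ #effective T rows)) ≤ fromℕ 2
  ∑boundTerm≤ []         _        = ≤-refl
  ∑boundTerm≤ (i ∷ rows) complete = case nonempty? (J i) of λ where
      (yes eff) → begin
        boundTerm i + Σ + fromℕ 2 * (1ℚ /ℕ (2 ^ #effective T (i ∷ rows)))
          ≡⟨ cong (λ e → boundTerm i + Σ + fromℕ 2 * (1ℚ /ℕ (2 ^ e))) (#effective-accept eff) ⟩
        boundTerm i + Σ + fromℕ 2 * (1ℚ /ℕ (2 ℕ.* 2 ^ #effective T rows))
          ≡⟨ cong (boundTerm i + Σ +_) (1/2d (2 ^ #effective T rows) {{ℕ.m^n≢0 2 (#effective T rows)}}) ⟩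
        -- The new term is at most h, and the remainder has shrunk from 2h to h, so the total does
        -- not grow.
        boundTerm i + Σ + h  ≤⟨ +-monoˡ-≤ h (+-monoˡ-≤ Σ (subst (λ e → boundTerm i ≤ 1ℚ /ℕ (2 ^ e)) (effectiveAfter≡ T complete) (boundTerm≤ i))) ⟩
        h + Σ + h            ≡⟨ solve 2 (λ h s → h :+ s :+ h := s :+ (con 1ℚ :+ con 1ℚ) :* h) refl h Σ ⟩
        Σ + fromℕ 2 * h      ≤⟨ ∑boundTerm≤ rows (tail-complete T complete) ⟩
        fromℕ 2              ∎
      (no ¬eff) → begin
        boundTerm i + Σ + fromℕ 2 * (1ℚ /ℕ (2 ^ #effective T (i ∷ rows)))
          ≡⟨ cong₂ (λ t e → t + Σ + fromℕ 2 * (1ℚ /ℕ (2 ^ e))) (boundTerm≡0 ¬eff) (#effective-reject ¬eff) ⟩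
        0ℚ + Σ + fromℕ 2 * h  ≡⟨ cong (_+ fromℕ 2 * h) (ℚ.+-identityˡ Σ) ⟩
        Σ + fromℕ 2 * h       ≤⟨ ∑boundTerm≤ rows (tail-complete T complete) ⟩
        fromℕ 2               ∎
    where
    open ≤-Reasoning
    Σ = ∑ rows boundTerm
    h = 1ℚ /ℕ (2 ^ #effective T rows)
    #effective-accept : Effective i → #effective T (i ∷ rows) ≡ suc (#effective T rows)
    #effective-accept eff = cong length (filter-accept (nonempty? ∘ J) eff)
    #effective-reject : ¬ Effective i → #effective T (i ∷ rows) ≡ #effective T rows
    #effective-reject ¬eff = cong length (filter-reject (nonempty? ∘ J) ¬eff)

  boundFactor≤3 : ∀ {r} → IsMaxEffective r → boundFactor T r ≤ fromℕ 3
  boundFactor≤3 {r} max = +-monoʳ-≤ 1ℚ (begin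
    ∑ rows boundTerm                                              ≡⟨ ℚ.+-identityʳ (∑ rows boundTerm) ⟨
    ∑ rows boundTerm + 0ℚ                                         ≤⟨ +-monoʳ-≤ (∑ rows boundTerm) (*-nonNeg (0≤fromℕ 2) (/ℕ-nonNeg (2 ^ #effective T rows) (0≤fromℕ 1))) ⟩
    ∑ rows boundTerm + fromℕ 2 * (1ℚ /ℕ (2 ^ #effective T rows))  ≤⟨ ∑boundTerm≤ rows (rowsUpTo-complete T max) ⟩
    fromℕ 2                                                       ∎)
    where
    open ≤-Reasoning
    rows = rowsUpTo r

  0≤boundFactor : ∀ r → 0ℚ ≤ boundFactor T r
  0≤boundFactor r = +-mono-≤ (0≤fromℕ 1) (∑-nonNeg (rowsUpTo r) 0≤boundTerm)

  -- For m at most N - (c i + 1) both falling factorials are positive, so γ can vanish only through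
  -- its second case.
  γ≡0⇒large : ∀ {i m} → m ℕ.≤ n ∸ toℕ i → γ T i m ≡ 0ℚ → n ∸ toℕ i ∸ (c i ℕ.+ 1) < m
  γ≡0⇒large {i} {m} m≤N γ≡0 = ℕ.≰⇒> λ m≤M → ℕ.<⇒≱ (1≤nPk m≤M) (fromℕ-cancel (begin
    fromℕ (M P m)                             ≡⟨ /ℕ-*-cancel (fromℕ (M P m)) (N P m) {{ℕ.>-nonZero (1≤nPk m≤N)}} ⟨
    fromℕ (M P m) /ℕ (N P m) * fromℕ (N P m)  ≡⟨ cong (λ b → (if b then fromℕ (M P m) /ℕ (N P m) else 0ℚ) * fromℕ (N P m)) (dec-true (m ℕ.≤? M) m≤M) ⟨
    γ T i m * fromℕ (N P m)                   ≡⟨ cong (_* fromℕ (N P m)) γ≡0 ⟩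
    0ℚ * fromℕ (N P m)                        ≡⟨ ℚ.*-zeroˡ (fromℕ (N P m)) ⟩
    0ℚ                                        ∎))
    where
    open ≡-Reasoning
    N = n ∸ toℕ i
    M = N ∸ (c i ℕ.+ 1)
    fromℕ-cancel : ∀ {x} → fromℕ x ≡ 0ℚ → x ℕ.≤ 0
    fromℕ-cancel {zero}  _  = z≤n
    fromℕ-cancel {suc x} eq = contradiction
      (ℚ.*-zeroʳ (ℤ.+ 1 / suc x))
      (λ z → case trans (sym (1/n*n≡1 x)) (trans (cong ((ℤ.+ 1 / suc x) *_) eq) z) of λ ())

-- No index lies below row 1, so its switches have nothing to fix, and transitivity makes every
-- later column non-trivial. Then only the empty set avoids 1 and J(1), whereas m is positive.
transitive⇒γ≡0 : ∀ {n p} {G : Subgroup (suc n) p} (T : SwitchTable G) →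
                 Transitive G → ∀ {m} → 0 < m → γ T zero m ≡ 0ℚ
transitive⇒γ≡0 {n} {G = G} T transitive {m} 0<m =
  cong (λ b → if b then fromℕ (M P m) /ℕ (suc n P m) else 0ℚ)
    (dec-false (m ℕ.≤? M) (λ m≤M → ℕ.<⇒≱ 0<m (ℕ.≤-trans m≤M (ℕ.≤-reflexive M≡0))))
  where
  open SwitchTable T
  M = suc n ∸ (c zero ℕ.+ 1)

  J-complete : ∁ ⁅ zero ⁆ ⊆ J zero
  J-complete {zero}  j∈ = contradiction (x∈⁅x⁆ zero) (x∈∁p⇒x∉p j∈)
  J-complete {suc j} _  = ∈-tabulate-does⁺ (nonTrivial? zero) (λ σ≈id →
    let (g , g∈G , gj≡0) = transitive (suc j) zero
        (_ , σj≡0 , _) = switch zero (suc j) z<s (g , g∈G , gj≡0 , λ _ ())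
    in contradiction (trans (sym σj≡0) (σ≈id (suc j))) (λ ()))

  M≡0 : M ≡ 0
  M≡0 = ℕ.m≤n⇒m∸n≡0 (begin
    suc n                     ≡⟨ cong suc (trans (∣∁p∣≡n∸∣p∣ (⁅ zero {n} ⁆)) (cong (suc n ∸_) (∣⁅x⁆∣≡1 (zero {n})))) ⟨
    suc ∣ ∁ (⁅ zero {n} ⁆) ∣  ≤⟨ s≤s (p⊆q⇒∣p∣≤∣q∣ J-complete) ⟩
    suc (c zero)              ≡⟨ ℕ.+-comm 1 (c zero) ⟩
    c zero ℕ.+ 1              ∎)
    where open ℕ.≤-Reasoning

-- The relative effort

effₘₛₜ≤ : ∀ {n p m k} {G : Subgroup (suc n) p} (T : SwitchTable G) → HasOrder G k →
       0 < m → m < suc n → ∀ {r} → SwitchTable.IsMaxEffective T r → γ T zero m ≡ 0ℚ →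
       effₘₛₜ T r k m ≤ boundFactor T r * ρ {suc n} zero m ²
effₘₛₜ≤ {n} {m = m} {k} T order 0<m m<n {r} max γ≡0 =
  ≤*⇒/ℕ≤ (k ℕ.* m) (*-nonNeg (0≤boundFactor T r) 0≤ρ²) (begin
    -- `rowsUpTo r` computes to `zero` followed by the list given here, because `zero` is at most
    -- every r.
    Eₘₛₜ T r m                  ≤⟨ firstRow≤ T (filter (Fin._≤? r) (tabulate suc)) 0<m m<n (γ≡0⇒large T {zero} (ℕ.<⇒≤ m<n) γ≡0) ⟩
    ρ₁ ² * fromℕ (m ℕ.* W)      ≡⟨ cong (ρ₁ ² *_) (fromℕ-homo-* m W) ⟩
    ρ₁ ² * (fromℕ m * fromℕ W)  ≤⟨ *-monoˡ-≤-nonNeg (ρ₁ ²) {{nonNegative 0≤ρ²}}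
                                                      (*-monoˡ-≤-nonNeg (fromℕ m) {{nonNegative (0≤fromℕ m)}} W≤) ⟩
    ρ₁ ² * (fromℕ m * (fromℕ k * boundFactor T r)) ≡⟨ rearrange (ρ₁ ²) (fromℕ m) (fromℕ k) (boundFactor T r) ⟩
    boundFactor T r * ρ₁ ² * (fromℕ k * fromℕ m)  ≡⟨ cong (boundFactor T r * ρ₁ ² *_) (fromℕ-homo-* k m) ⟨
    boundFactor T r * ρ₁ ² * fromℕ (k ℕ.* m)      ∎)
  where
  open ≤-Reasoning
  ρ₁ = ρ {suc n} zero m
  W  = costWeight T (rowsUpTo r)
  complete = rowsUpTo-complete T max

  0≤ρ² : 0ℚ ≤ ρ₁ ²
  0≤ρ² = subst (λ x → 0ℚ ≤ x ²) (sym (ρ-zero 0<m m<n))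
    (*-nonNeg (/ℕ-nonNeg (suc n) (0≤fromℕ m)) (/ℕ-nonNeg (suc n) (0≤fromℕ m)))

  W≤ : fromℕ W ≤ fromℕ k * boundFactor T r
  W≤ = ≤-trans (costWeight≤ T (rowsUpTo r) complete)
    (*-monoʳ-≤-nonNeg (boundFactor T r) {{nonNegative (0≤boundFactor T r)}}
      (fromℕ-mono-≤ (#switches≤order T (proj₁ complete) order)))

  rearrange : ∀ r m k b → r * (m * (k * b)) ≡ b * r * (k * m)
  rearrange = solve 4 (λ r m k b → r :* (m :* (k :* b)) := b :* r :* (k :* m)) refl

corollary5 : ∀ {p} {n m k : ℕ} (0<m : 0 < m) (m<n : m < n)
    (G : Subgroup n p) → HasOrder G k → (T : SwitchTable G) →
    let row₁ = fromℕ< (<-trans 0<m m<n) in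
    (Transitive G → γ T row₁ m ≡ 0ℚ)
    × ((r : Fin n) → SwitchTable.IsMaxEffective T r →
       γ T row₁ m ≡ 0ℚ →
       ρ r m ² + μ n ² ≤ 1ℚ →
       (effₘₛₜ T r k m ≤ boundFactor T r * ρ row₁ m ²)
       × (boundFactor T r * ρ row₁ m ² ≤ fromℕ 3 * ρ row₁ m ²))
-- Matching on `suc n` lets the first row index reduce to `zero`.
corollary5 {n = suc n} {m} 0<m m<n G order T =
    (λ transitive → transitive⇒γ≡0 T transitive 0<m)
  , λ _ max γ≡0 _ → effₘₛₜ≤ T order 0<m m<n max γ≡0
                  , *-monoʳ-≤-nonNeg (ρ {suc n} zero m ²)
                      {{nonNegative (subst (λ x → 0ℚ ≤ x ²) (sym (ρ-zero 0<m m<n)) (*-nonNeg 0≤m/n 0≤m/n))}}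
                      (boundFactor≤3 T max)
  where 0≤m/n = /ℕ-nonNeg (suc n) (0≤fromℕ m)
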